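{- Let $k$ be a positive integer and $p$ a prime with $p\equiv 3\pmod 4$. Let $\delta$ be a non-negative integer such that $p$ divides $4\delta+3$. Then for every non-negative integer $n$, $\mathcal{J}_{10}(N_1)$ and $\mathcal{J}_{10}(N_2)$ have the same parity, where \[ N_1=p\left(4p^k n+4\delta+3\right),\qquad N_2=4p^{k-1}n+\frac{4\delta+3}{p}. \]
   Context: Let $q=e^{2\pi i\tau}$ with $\tau$ in the upper half-plane, and let $\eta(\tau)=q^{1/24}\prod_{n\ge1}(1-q^n)$ be the Dedekind eta function. The Hauptmodul of $\Gamma_0(10)$ is \[ j_{10}(\tau)=\frac{\eta(2\tau)\eta(5\tau)^5}{\eta(\tau)\eta(10\tau)^5}-1=\frac1q+\sum_{n\ge1}\mathcal{J}_{10}(n)q^n, \] and $\mathcal{J}_{10}(n)$ denotes its $n$-th Fourier coefficient (an integer). -}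

module Defs where

open import Data.Nat as ℕ using (ℕ; zero; suc; _∸_)
open import Data.Nat.Divisibility using (_∣?_)
open import Data.Integer using (ℤ; +_; -_; _+_; _*_; _-_)
open import Data.List using (List; map; upTo; foldr)
open import Relation.Nullary.Decidable using (⌊_⌋)
open import Data.Bool using (if_then_else_)

Series : Set
Series = ℕ → ℤ

_⊛_ : Series → Series → Series
(f ⊛ g) m = foldr _+_ (+ 0) (map (λ i → f i * g (m ∸ i)) (upTo (suc m)))

infixl 7 _⊛_

oneS : Series
oneS zero    = + 1
oneS (suc _) = + 0

_^S_ : Series → ℕ → Series
f ^S zero  = oneS
f ^S suc e = f ⊛ (f ^S e)

-- 1 - q^k  (used with k ≥ 1)
oneMinusQ : ℕ → Series
oneMinusQ k zero    = + 1
oneMinusQ k (suc m) = if ⌊ k ℕ.≟ suc m ⌋ then - (+ 1) else + 0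

-- 1 / (1 - q^k) = Σ_j q^{k j}  (used with k ≥ 1)
geomS : ℕ → Series
geomS k m = if ⌊ k ∣? m ⌋ then + 1 else + 0

factor : ℕ → Series
factor n = oneMinusQ (2 ℕ.* n) ⊛ (oneMinusQ (5 ℕ.* n) ^S 5)
           ⊛ geomS n ⊛ (geomS (10 ℕ.* n) ^S 5)

prodUpTo : ℕ → Series
prodUpTo zero    = oneS
prodUpTo (suc N) = prodUpTo N ⊛ factor (suc N)

-- Coefficient of q^m in the infinite product ∏_{n≥1} factor n.
-- Factors with n > m are 1 + O(q^n), so truncating at N = m is exact.
etaQuotCoeff : ℕ → ℤ
etaQuotCoeff m = prodUpTo m m

-- j10(τ) = q^{-1} · ∏_{n≥1} factor n  - 1  =  1/q + Σ_{n≥1} J10(n) q^n.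
-- J10 n is the coefficient of q^n in j10 (n = 0 gives the constant term, which is 0).
J10 : ℕ → ℤ
J10 zero    = etaQuotCoeff 1 - + 1
J10 (suc n) = etaQuotCoeff (suc (suc n))

{-# OPTIONS --safe #-}

-- Modulo 2, q·(j₁₀ + 1) = f₁/f₅⁵ with fₖ = ∏ (1 − q^{kn}), since f₂ₖ ≡ fₖ².  Everything rests on
--     f₁ f₅ ≡ ψ(q)² + q ψ(q⁵)² ,      ψ(q) = Σ_{k ∈ ℤ} q^{2k² − k} ≡ f₁³   (mod 2).
-- By the Jacobi triple product f₁ f₅ ≡ f(q, q⁴) f(q², q³), and ψ(q)² = f(q, q⁴) f(q², q³) + q ψ(q⁵)²
-- is a bijection of lattices: multiplication by 1 ± 2i in ℤ[i], up to units.  Hence f₁/f₅⁵ ≡ X² + q with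
-- X = (f₁/f₅)³ ≡ (f₁⁴/f₅²)² + q (f₁f₅)², so the coefficient of q^{4j+1} in j₁₀ has the parity of the
-- coefficient of q^j in f₁ f₅, which is odd exactly when 4j + 1 is s² or 5s².  For a prime p ≠ 5 this
-- condition is insensitive to a factor p², and N₁ = p² N₂ with N₂ ≡ 1 (mod 4).
module Submission where

open import Defs
open import Data.Nat using (ℕ; _+_; _*_; _^_; _∸_; _≤_; _%_; _/_; NonZero)
open import Data.Nat.Divisibility using (_∣_)
open import Data.Nat.Primality using (Prime)
open import Data.Integer using (+_; _-_)
open import Data.Integer.Divisibility as ℤD using ()
open import Relation.Binary.PropositionalEquality using (_≡_)

open import Algebra.Bundles using (CommutativeRing; CommutativeSemiring)
import Algebra.Solver.Ring as RingSolver
open import Algebra.Solver.Ring.AlmostCommutativeRing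
  using (fromCommutativeSemiring; _-Raw-AlmostCommutative⟶_)
open import Data.Bool.Base using (Bool; true; false; _∧_; _xor_; if_then_else_)
open import Data.Bool.Properties
  using (xor-assoc; xor-comm; xor-identityʳ; xor-same; ∧-assoc; ∧-comm; ∧-idem;
         ∧-distribˡ-xor; ∧-distribʳ-xor; xor-∧-commutativeRing; ⇔→≡)
open import Data.Bool.Solver using (module xor-∧-Solver)
open import Data.Empty using (⊥)
open import Data.Fin.Base using (Fin; toℕ; fromℕ<)
open import Data.Fin.Patterns using (0F; 1F; 2F; 3F; 4F)
open import Data.Fin.Properties using (toℕ-fromℕ<; toℕ<n; toℕ-injective)
open import Data.Integer.Base as ℤ using (ℤ; -[1+_]; _⊖_; ∣_∣)
import Data.Integer.DivMod as ℤ
import Data.Integer.Properties as ℤ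
import Data.Integer.Solver as ℤ-Solver
import Data.Integer.Tactic.RingSolver as ℤ using (solve-∀)
open import Data.List.Base
  using (List; []; _∷_; _++_; map; filter; foldr; applyUpTo; cartesianProduct)
open import Data.List.Membership.Propositional using (_∈_)
open import Data.List.Membership.Propositional.Properties
open import Data.List.Membership.Propositional.Properties.WithK using (unique∧set⇒bag)
open import Data.List.Properties using (filter-accept; filter-reject; map-upTo)
open import Data.List.Relation.Binary.BagAndSetEquality using (∼bag⇒↭)
open import Data.List.Relation.Binary.Permutation.Propositional as ↭ using (_↭_)
open import Data.List.Relation.Unary.All as All using ()
open import Data.List.Relation.Unary.AllPairs using (_∷_)
open import Data.List.Relation.Unary.Any using (here; there)
open import Data.List.Relation.Unary.Unique.Propositional using (Unique)
import Data.List.Relation.Unary.Unique.Propositional.Properties as Unique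
open import Data.Maybe.Base using (Maybe; just; nothing)
open import Data.Nat.Base using (zero; suc; 2+; _<_; z≤n; s≤s; z<s; >-nonZero)
open import Data.Nat.Divisibility
  using (_∣?_; divides; _∣0; ∣-refl; ∣⇒≤; >⇒∤; ∣1⇒≡1; ∣m∣n⇒∣m+n; ∣m+n∣m⇒∣n; ∣m⇒∣m*n; ∣n⇒∣m*n; m∣m*n; n∣m⇒m%n≡0)
open import Data.Nat.DivMod using (m≡m%n+[m/n]*n; m%n<n; m/n*n≡m; %-distribˡ-*; [m+kn]%n≡m%n)
open import Data.Nat.Primality using (euclidsLemma)
open import Data.Nat.Properties
open import Data.Nat.Tactic.RingSolver using (solve-∀)
open import Data.Product.Base using (_×_; _,_; proj₁; proj₂; ∃)
open import Data.Sum.Base using (_⊎_; inj₁; inj₂; [_,_]′)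
open import Data.Sum.Properties using (inj₁-injective; inj₂-injective)
open import Function.Base using (_∘_; id)
open import Function.Bundles using (mk⇔)
open import Relation.Binary.PropositionalEquality
  using (_≢_; refl; sym; trans; cong; cong₂; subst; subst₂; module ≡-Reasoning)
import Relation.Binary.Reasoning.Setoid as SetoidReasoning
open import Relation.Nullary using (¬_; does; yes; no; contradiction)
open import Relation.Nullary.Decidable using (⌊_⌋; isYes≗does; dec-true; dec-false)

-- Power series over 𝔽₂

-- Over 𝔽₂ squaring is the substitution q ↦ q², so in a series u² + q v² the even coefficients are
-- those of u and the odd ones those of v. The identity for f₁ f₅ has this shape and keeps it after
-- multiplication by a square: by f₅⁻⁶ for f₁/f₅⁵, by (f₁/f₅²)² for X. Taking an even coefficient
-- and then an odd one therefore leads from f₁/f₅⁵ back to f₁ f₅. A last use of the identity leaves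
-- a single coefficient of ψ(q) or ψ(q⁵); the exponents of these series are pairwise distinct, so
-- nothing cancels modulo 2, and 8(2k² - k) + 1 = (4k - 1)² turns them into squares. The congruence
-- ψ ≡ f₁³ is ψ ≡ f₁ f₄ / f₂ with f₂ ≡ f₁² and f₄ ≡ f₁⁴. No infinite product or sum occurs: every
-- identity is a congruence modulo q^(N+1) between finite objects, and N is in the end the degree of
-- the wanted coefficient. Hence the triple product is derived from its finite form, with explicit
-- bounds for the tails.

Series₂ : Set
Series₂ = ℕ → Bool

infixl 6 _⊞_
infixl 7 _⊠_

0ˢ 1ˢ : Series₂
0ˢ _ = false
1ˢ zero    = true
1ˢ (suc _) = false

-- Opaque so that unification treats _⊞_ as a head symbol.
opaque
  _⊞_ : Series₂ → Series₂ → Series₂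
  (f ⊞ g) n = f n xor g n

  ⊞-coeff : ∀ f g n → (f ⊞ g) n ≡ f n xor g n
  ⊞-coeff f g n = refl

  ⊞-assoc : ∀ f g h n → ((f ⊞ g) ⊞ h) n ≡ (f ⊞ (g ⊞ h)) n
  ⊞-assoc f g h n = xor-assoc (f n) (g n) (h n)

  ⊞-comm : ∀ f g n → (f ⊞ g) n ≡ (g ⊞ f) n
  ⊞-comm f g n = xor-comm (f n) (g n)

  ⊞-identityˡ : ∀ f n → (0ˢ ⊞ f) n ≡ f n
  ⊞-identityˡ f n = refl

  ⊞-self : ∀ f n → (f ⊞ f) n ≡ false
  ⊞-self f n = xor-same (f n)

_⊠_ : Series₂ → Series₂ → Series₂
(f ⊠ g) zero    = f 0 ∧ g 0
(f ⊠ g) (suc n) = (f 0 ∧ g (suc n)) xor ((f ∘ suc) ⊠ g) n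

xor-interchange : ∀ a b c d → (a xor b) xor (c xor d) ≡ (a xor c) xor (b xor d)
xor-interchange = solve 4 (λ a b c d → (a :+ b) :+ (c :+ d) := (a :+ c) :+ (b :+ d)) refl
  where open xor-∧-Solver

-- Coefficient `n` of a product sees only coefficients up to `n` of the factors; this makes
-- truncation compatible with multiplication.
⊠-cong≤ : ∀ {f f′ g g′ : Series₂} n → (∀ i → i ≤ n → f i ≡ f′ i) → (∀ i → i ≤ n → g i ≡ g′ i) →
          (f ⊠ g) n ≡ (f′ ⊠ g′) n
⊠-cong≤ zero    p q = cong₂ _∧_ (p 0 z≤n) (q 0 z≤n)
⊠-cong≤ (suc n) p q = cong₂ _xor_ (cong₂ _∧_ (p 0 z≤n) (q (suc n) ≤-refl))
  (⊠-cong≤ n (λ i i≤n → p (suc i) (s≤s i≤n)) (λ i i≤n → q i (m≤n⇒m≤1+n i≤n)))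

⊠-zeroˡ : ∀ f n → (0ˢ ⊠ f) n ≡ false
⊠-zeroˡ f zero    = refl
⊠-zeroˡ f (suc n) = ⊠-zeroˡ f n

⊠-identityˡ : ∀ f n → (1ˢ ⊠ f) n ≡ f n
⊠-identityˡ f zero    = refl
⊠-identityˡ f (suc n) = trans (cong (f (suc n) xor_) (⊠-zeroˡ f n)) (xor-identityʳ _)

opaque
  unfolding _⊞_

  ⊠-distribʳ : ∀ h f g n → ((f ⊞ g) ⊠ h) n ≡ (f ⊠ h ⊞ g ⊠ h) n
  ⊠-distribʳ h f g zero    = ∧-distribʳ-xor (h 0) (f 0) (g 0)
  ⊠-distribʳ h f g (suc n) = trans
    (cong₂ _xor_ (∧-distribʳ-xor (h (suc n)) (f 0) (g 0)) (⊠-distribʳ h (f ∘ suc) (g ∘ suc) n))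
    (xor-interchange (f 0 ∧ h (suc n)) _ _ _)

⊠-scaleˡ : ∀ c f g n → (((c ∧_) ∘ f) ⊠ g) n ≡ c ∧ (f ⊠ g) n
⊠-scaleˡ c f g zero    = ∧-assoc c _ _
⊠-scaleˡ c f g (suc n) = trans
  (cong₂ _xor_ (∧-assoc c (f 0) (g (suc n))) (⊠-scaleˡ c (f ∘ suc) g n))
  (sym (∧-distribˡ-xor c _ _))

-- The definition peels the convolution at its first term; commutativity and squaring also need to
-- peel it at the last.
⊠-unfoldʳ : ∀ f g n → (f ⊠ g) (suc n) ≡ (f ⊠ (g ∘ suc)) n xor (f (suc n) ∧ g 0)
⊠-unfoldʳ f g zero    = refl
⊠-unfoldʳ f g (suc n) = trans
  (cong ((f 0 ∧ g (2+ n)) xor_) (⊠-unfoldʳ (f ∘ suc) g n))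
  (sym (xor-assoc (f 0 ∧ g (2+ n)) _ _))

⊠-comm : ∀ f g n → (f ⊠ g) n ≡ (g ⊠ f) n
⊠-comm f g zero    = ∧-comm (f 0) (g 0)
⊠-comm f g (suc n) = begin
  (f 0 ∧ g (suc n)) xor ((f ∘ suc) ⊠ g) n ≡⟨ cong₂ _xor_ (∧-comm (f 0) _) (⊠-comm (f ∘ suc) g n) ⟩
  (g (suc n) ∧ f 0) xor (g ⊠ (f ∘ suc)) n ≡⟨ xor-comm (g (suc n) ∧ f 0) _ ⟩
  (g ⊠ (f ∘ suc)) n xor (g (suc n) ∧ f 0) ≡⟨ ⊠-unfoldʳ g f n ⟨
  (g ⊠ f) (suc n)                         ∎
  where open ≡-Reasoning

opaque
  unfolding _⊞_

  ⊠-assoc : ∀ f g h n → ((f ⊠ g) ⊠ h) n ≡ (f ⊠ (g ⊠ h)) n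
  ⊠-assoc f g h zero    = ∧-assoc (f 0) (g 0) (h 0)
  ⊠-assoc f g h (suc n) = begin
    ((f₀ ∧ g 0) ∧ h (suc n)) xor ((((f₀ ∧_) ∘ g ∘ suc) ⊞ ((f ∘ suc) ⊠ g)) ⊠ h) n
      ≡⟨ cong₂ _xor_ (∧-assoc f₀ _ _) (⊠-distribʳ h ((f₀ ∧_) ∘ g ∘ suc) ((f ∘ suc) ⊠ g) n) ⟩
    (f₀ ∧ (g 0 ∧ h (suc n))) xor ((((f₀ ∧_) ∘ g ∘ suc) ⊠ h) n xor (((f ∘ suc) ⊠ g) ⊠ h) n)
      ≡⟨ cong ((f₀ ∧ (g 0 ∧ h (suc n))) xor_)
           (cong₂ _xor_ (⊠-scaleˡ f₀ (g ∘ suc) h n) (⊠-assoc (f ∘ suc) g h n)) ⟩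
    (f₀ ∧ (g 0 ∧ h (suc n))) xor ((f₀ ∧ ((g ∘ suc) ⊠ h) n) xor ((f ∘ suc) ⊠ (g ⊠ h)) n)
      ≡⟨ xor-assoc (f₀ ∧ (g 0 ∧ h (suc n))) _ _ ⟨
    ((f₀ ∧ (g 0 ∧ h (suc n))) xor (f₀ ∧ ((g ∘ suc) ⊠ h) n)) xor ((f ∘ suc) ⊠ (g ⊠ h)) n
      ≡⟨ cong (_xor ((f ∘ suc) ⊠ (g ⊠ h)) n) (∧-distribˡ-xor f₀ _ _) ⟨
    (f ⊠ (g ⊠ h)) (suc n) ∎
    where
    open ≡-Reasoning
    f₀ : Bool
    f₀ = f 0

-- Frobenius in characteristic 2: the cross terms of f² cancel in pairs. `square-step` removes the
-- outermost pair and leaves the square of the shifted series, two degrees lower.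
square-even : ∀ f n → (f ⊠ f) (n + n) ≡ f n
square-odd  : ∀ f n → (f ⊠ f) (suc (n + n)) ≡ false

square-step : ∀ f n → (f ⊠ f) (2+ n) ≡ ((f ∘ suc) ⊠ (f ∘ suc)) n
square-step f n = begin
  (f 0 ∧ f (2+ n)) xor ((f ∘ suc) ⊠ f) (suc n)
    ≡⟨ cong ((f 0 ∧ f (2+ n)) xor_) (⊠-unfoldʳ (f ∘ suc) f n) ⟩
  (f 0 ∧ f (2+ n)) xor (((f ∘ suc) ⊠ (f ∘ suc)) n xor (f (2+ n) ∧ f 0))
    ≡⟨ lemma (f 0) (f (2+ n)) _ ⟩
  ((f ∘ suc) ⊠ (f ∘ suc)) n ∎
  where
  open ≡-Reasoning
  lemma : ∀ a b c → (a ∧ b) xor (c xor (b ∧ a)) ≡ c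
  lemma false false false = refl
  lemma false false true  = refl
  lemma false true  false = refl
  lemma false true  true  = refl
  lemma true  false false = refl
  lemma true  false true  = refl
  lemma true  true  false = refl
  lemma true  true  true  = refl

square-even f zero = ∧-idem (f 0)
square-even f (suc n) rewrite +-suc n n = trans (square-step f (n + n)) (square-even (f ∘ suc) n)

square-odd f zero rewrite ∧-comm (f 1) (f 0) = xor-same (f 0 ∧ f 1)
square-odd f (suc n) rewrite +-suc n n = trans (square-step f (suc (n + n))) (square-odd (f ∘ suc) n)

mono : ℕ → Series₂
mono zero            = 1ˢ
mono (suc e) zero    = false
mono (suc e) (suc n) = mono e n

mono-above : ∀ e n → n < e → mono e n ≡ false
mono-above (suc e) zero    _         = refl
mono-above (suc e) (suc n) (s≤s n<e) = mono-above e n n<e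

mono-⊠-below : ∀ e f n → n < e → (mono e ⊠ f) n ≡ false
mono-⊠-below (suc e) f zero    _         = refl
mono-⊠-below (suc e) f (suc n) (s≤s n<e) = mono-⊠-below e f n n<e

mono-⊠-mono : ∀ d e n → (mono d ⊠ mono e) n ≡ mono (d + e) n
mono-⊠-mono zero    e n       = ⊠-identityˡ (mono e) n
mono-⊠-mono (suc d) e zero    = refl
mono-⊠-mono (suc d) e (suc n) = mono-⊠-mono d e n

mono-⊠-shift : ∀ e f n → (mono e ⊠ f) (e + n) ≡ f n
mono-⊠-shift zero    f n = ⊠-identityˡ f n
mono-⊠-shift (suc e) f n = mono-⊠-shift e f n

geom₂ : ℕ → Series₂
geom₂ k n = does (k ∣? n)

-- The indicator of the multiples of `k` is `k`-periodic, so adding its shift by `k` cancels every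
-- degree from `k` on; below `k` only the constant term survives.
geom-inverse : ∀ k → 0 < k → ∀ n → ((1ˢ ⊞ mono k) ⊠ geom₂ k) n ≡ 1ˢ n
geom-inverse k 0<k n = trans (⊠-distribʳ (geom₂ k) 1ˢ (mono k) n) (trans (⊞-coeff (1ˢ ⊠ geom₂ k) _ n)
  (trans (cong (_xor (mono k ⊠ geom₂ k) n) (⊠-identityˡ (geom₂ k) n)) (split n)))
  where
  small : ∀ n → n < k → geom₂ k n ≡ 1ˢ n
  small zero    _ = dec-true (k ∣? 0) (k ∣0)
  small (suc n) n<k = dec-false (k ∣? suc n) (>⇒∤ n<k)
  periodic : ∀ n → geom₂ k (k + n) ≡ geom₂ k n
  periodic n with k ∣? n
  ... | yes p = dec-true (k ∣? (k + n)) (∣m∣n⇒∣m+n ∣-refl p)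
  ... | no ¬p = dec-false (k ∣? (k + n)) (λ q → ¬p (∣m+n∣m⇒∣n q ∣-refl))
  1ˢ-large : ∀ k n → 0 < k → 1ˢ (k + n) ≡ false
  1ˢ-large (suc k) n _ = refl
  split : ∀ n → geom₂ k n xor (mono k ⊠ geom₂ k) n ≡ 1ˢ n
  split n with n <? k
  ... | yes n<k = trans (cong₂ _xor_ (small n n<k) (mono-⊠-below k _ n n<k)) (xor-identityʳ _)
  ... | no n≮k with m≤n⇒∃[o]m+o≡n (≮⇒≥ n≮k)
  ...   | m , refl = trans (cong₂ _xor_ (periodic m) (mono-⊠-shift k _ m))
                       (trans (xor-same (geom₂ k m)) (sym (1ˢ-large k m 0<k)))

prod : ℕ → (ℕ → Series₂) → Series₂
prod zero    f = 1ˢ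
prod (suc n) f = prod n f ⊠ f n

-- The sum over j + l = M. Carrying both indices avoids the subtraction M - j.
antidiag : ℕ → (ℕ → ℕ → Series₂) → Series₂
antidiag zero    F = F 0 0
antidiag (suc M) F = F 0 (suc M) ⊞ antidiag M (F ∘ suc)

-- `prod n (fac a c)` is the q-Pochhammer symbol (q^a; q^c)_n; its minus signs vanish modulo 2.
fac : ℕ → ℕ → ℕ → Series₂
fac a c i = 1ˢ ⊞ mono (a + c * i)

euler : ℕ → ℕ → Series₂
euler c = λ n → prod n (fac c c)


-- The ring of power series modulo q^(N+1).

module Trunc (N : ℕ) where

  infix 4 _≈_
  -- A record instead of a bare function type, so that `f` and `g` can be inferred from a proof.
  record _≈_ (f g : Series₂) : Set where
    constructor agree
    field at : ∀ i → i ≤ N → f i ≡ g i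
  open _≈_ public

  pointwise : ∀ {f g : Series₂} → (∀ i → f i ≡ g i) → f ≈ g
  pointwise p = agree λ i _ → p i

  seriesRing : CommutativeSemiring _ _
  seriesRing = record
    { _≈_ = _≈_ ; _+_ = _⊞_ ; _*_ = _⊠_ ; 0# = 0ˢ ; 1# = 1ˢ
    ; isCommutativeSemiring = record
      { isSemiring = record
        { isSemiringWithoutAnnihilatingZero = record
          { +-isCommutativeMonoid = record
            { isMonoid = record
              { isSemigroup = record
                { isMagma = record
                  { isEquivalence = record
                    { refl  = pointwise λ _ → refl
                    ; sym   = λ p → agree λ i i≤N → sym (at p i i≤N)
                    ; trans = λ p q → agree λ i i≤N → trans (at p i i≤N) (at q i i≤N)
                    }
                  ; ∙-cong = λ {f} {f′} {g} {g′} p q → agree λ i i≤N → trans (⊞-coeff f g i)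
                      (trans (cong₂ _xor_ (at p i i≤N) (at q i i≤N)) (sym (⊞-coeff f′ g′ i)))
                  }
                ; assoc = λ f g h → pointwise (⊞-assoc f g h)
                }
              ; identity = (λ f → pointwise (⊞-identityˡ f))
                         , (λ f → pointwise λ i → trans (⊞-comm f 0ˢ i) (⊞-identityˡ f i))
              }
            ; comm = λ f g → pointwise (⊞-comm f g)
            }
          ; *-cong = λ p q → agree λ i i≤N →
              ⊠-cong≤ i (λ j j≤i → at p j (≤-trans j≤i i≤N)) (λ j j≤i → at q j (≤-trans j≤i i≤N))
          ; *-assoc = λ f g h → pointwise (⊠-assoc f g h)
          ; *-identity = (λ f → pointwise (⊠-identityˡ f))
                       , (λ f → pointwise λ i → trans (⊠-comm f 1ˢ i) (⊠-identityˡ f i))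
          ; distrib = (λ h f g → agree λ i i≤N → trans (⊠-comm h (f ⊞ g) i)
                        (trans (⊠-distribʳ h f g i) (trans (⊞-coeff (f ⊠ h) (g ⊠ h) i)
                        (trans (cong₂ _xor_ (⊠-comm f h i) (⊠-comm g h i)) (sym (⊞-coeff (h ⊠ f) (h ⊠ g) i))))))
                    , (λ h f g → pointwise (⊠-distribʳ h f g))
          }
        ; zero = (λ f → pointwise (⊠-zeroˡ f))
               , (λ f → pointwise λ i → trans (⊠-comm f 0ˢ i) (⊠-zeroˡ f i))
        }
      ; *-comm = λ f g → pointwise (⊠-comm f g)
      }
    }

  open CommutativeSemiring seriesRing public
    using ()
    renaming (setoid to ≈-setoid; refl to ≈-refl; sym to ≈-sym; trans to ≈-trans; +-cong to ⊞-cong; *-cong to ⊠-cong)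

  constant : Bool → Series₂
  constant true  = 1ˢ
  constant false = 0ˢ

  -- With coefficients in 𝔽₂ the solver also knows that 1 + 1 = 0.
  private
    𝔽₂ = CommutativeRing.rawRing xor-∧-commutativeRing
    homo : 𝔽₂ -Raw-AlmostCommutative⟶ fromCommutativeSemiring seriesRing
    homo = record
      { ⟦_⟧    = constant
      ; +-homo = +-homo
      ; *-homo = *-homo
      ; -‿homo = λ _ → ≈-refl
      ; 0-homo = ≈-refl
      ; 1-homo = ≈-refl
      }
      where
      +-homo : ∀ a b → constant (a xor b) ≈ constant a ⊞ constant b
      +-homo false b     = ≈-sym (pointwise (⊞-identityˡ _))
      +-homo true  false = ≈-sym (pointwise λ i → trans (⊞-comm 1ˢ 0ˢ i) (⊞-identityˡ 1ˢ i))
      +-homo true  true  = ≈-sym (pointwise (⊞-self 1ˢ))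
      *-homo : ∀ a b → constant (a ∧ b) ≈ constant a ⊠ constant b
      *-homo false b = ≈-sym (pointwise (⊠-zeroˡ (constant b)))
      *-homo true  b = ≈-sym (pointwise (⊠-identityˡ (constant b)))
    dec : ∀ a b → Maybe (constant a ≈ constant b)
    dec false false = just ≈-refl
    dec true  true  = just ≈-refl
    dec _     _     = nothing

  module Solver = RingSolver 𝔽₂ (fromCommutativeSemiring seriesRing) homo dec
  open Solver using (solve; _:+_; _:*_; _:=_; con; _:^_)
  module ≈-Reasoning = SetoidReasoning ≈-setoid

  ≡⇒≈ : ∀ {f g} → f ≡ g → f ≈ g
  ≡⇒≈ refl = ≈-refl

  ⊠-congˡ : ∀ {f g} h → f ≈ g → h ⊠ f ≈ h ⊠ g
  ⊠-congˡ h = ⊠-cong ≈-refl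

  ⊠-congʳ : ∀ {f g} h → f ≈ g → f ⊠ h ≈ g ⊠ h
  ⊠-congʳ h p = ⊠-cong p ≈-refl

  mono-+ : ∀ d e → mono (d + e) ≈ mono d ⊠ mono e
  mono-+ d e = ≈-sym (pointwise (mono-⊠-mono d e))

  mono-vanish : ∀ {e} → N < e → ∀ f → mono e ⊠ f ≈ 0ˢ
  mono-vanish N<e f = agree λ i i≤N → mono-⊠-below _ f i (≤-<-trans i≤N N<e)

  prod-cong : ∀ n {f g} → (∀ i → i < n → f i ≈ g i) → prod n f ≈ prod n g
  prod-cong zero    p = ≈-refl
  prod-cong (suc n) p = ⊠-cong (prod-cong n λ i i<n → p i (m<n⇒m<1+n i<n)) (p n ≤-refl)

  prod-⊠ : ∀ n f g → prod n (λ i → f i ⊠ g i) ≈ prod n f ⊠ prod n g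
  prod-⊠ zero    f g = ≈-sym (pointwise (⊠-identityˡ 1ˢ))
  prod-⊠ (suc n) f g = ≈-trans (⊠-congʳ (f n ⊠ g n) (prod-⊠ n f g))
    (solve 4 (λ a b c d → (a :* b) :* (c :* d) := (a :* c) :* (b :* d)) ≈-refl _ _ _ _)

  prod-1 : ∀ n → prod n (λ _ → 1ˢ) ≈ 1ˢ
  prod-1 zero    = ≈-refl
  prod-1 (suc n) = ≈-trans (⊠-congʳ 1ˢ (prod-1 n)) (pointwise (⊠-identityˡ 1ˢ))

  antidiag-cong : ∀ M {F G} → (∀ j l → j + l ≡ M → F j l ≈ G j l) → antidiag M F ≈ antidiag M G
  antidiag-cong zero    p = p 0 0 refl
  antidiag-cong (suc M) p =
    ⊞-cong (p 0 (suc M) refl) (antidiag-cong M λ j l j+l≡M → p (suc j) l (cong suc j+l≡M))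

  antidiag-⊠ : ∀ M F g → antidiag M (λ j l → F j l ⊠ g) ≈ antidiag M F ⊠ g
  antidiag-⊠ zero    F g = ≈-refl
  antidiag-⊠ (suc M) F g = ≈-trans (⊞-cong ≈-refl (antidiag-⊠ M (F ∘ suc) g))
    (≈-sym (pointwise (⊠-distribʳ g _ _)))

  private
    antidiag-merge′ : ∀ M U S T →
      (∀ j → j ≡ suc M → U j 0 ≈ T j 0) →
      (∀ j l → j + l ≡ M → U j (suc l) ≈ S j l ⊞ T j (suc l)) →
      antidiag (suc M) U ≈ antidiag M S ⊞ antidiag (suc M) T
    antidiag-merge′ zero U S T p q = ≈-trans (⊞-cong (q 0 0 refl) (p 1 refl))
      (solve 3 (λ s t u → (s :+ t) :+ u := s :+ (t :+ u)) ≈-refl _ _ _)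
    antidiag-merge′ (suc M) U S T p q = ≈-trans
      (⊞-cong (q 0 (suc M) refl)
        (antidiag-merge′ M (U ∘ suc) (S ∘ suc) (T ∘ suc) (λ j e → p (suc j) (cong suc e)) (λ j l e → q (suc j) l (cong suc e))))
      (solve 4 (λ s t u v → (s :+ t) :+ (u :+ v) := (s :+ u) :+ (t :+ v)) ≈-refl _ _ _ _)

  -- Pascal's rule for a whole row: an inner entry receives one piece from (j, l - 1) and one from
  -- (j - 1, l), while each end receives only one.
  antidiag-merge : ∀ M U S T →
    (∀ l → l ≡ M → U 0 (suc l) ≈ S 0 l) →
    (∀ j l → suc (j + l) ≡ M → U (suc j) (suc l) ≈ S (suc j) l ⊞ T j (suc l)) →
    (∀ j → j ≡ M → U (suc j) 0 ≈ T j 0) →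
    antidiag (suc M) U ≈ antidiag M S ⊞ antidiag M T
  antidiag-merge zero U S T    p q r = ⊞-cong (p 0 refl) (r 0 refl)
  antidiag-merge (suc M) U S T p q r = ≈-trans
    (⊞-cong (p (suc M) refl) (antidiag-merge′ M (U ∘ suc) (S ∘ suc) T r (λ j l e → q j l (cong suc e))))
    (solve 3 (λ s t u → s :+ (t :+ u) := (s :+ t) :+ u) ≈-refl _ _ _)

  fac-inverse : ∀ a c i → 0 < a → fac a c i ⊠ geom₂ (a + c * i) ≈ 1ˢ
  fac-inverse a c i 0<a = pointwise (geom-inverse (a + c * i) (≤-trans 0<a (m≤m+n a _)))

-- The Jacobi triple product modulo 2

choose2 : ℕ → ℕ
choose2 zero    = 0
choose2 (suc k) = choose2 k + k

-- The exponent a·k(k+1)/2 + b·k(k−1)/2 of Ramanujan's f(q^a, q^b), for k = j − m.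
expo : ℕ → ℕ → ℕ → ℕ → ℕ
expo a b zero    j       = (a + b) * choose2 j + a * j
expo a b (suc m) zero    = (a + b) * choose2 (suc m) + b * suc m
expo a b (suc m) (suc j) = expo a b m j

-- Consecutive exponents differ by (a + b)k + a with k = j - m; the part (a + b)m stands on the left
-- so that everything stays in ℕ.
expo-suc : ∀ a b m j → expo a b m (suc j) + (a + b) * m ≡ expo a b m j + (a + b) * j + a
expo-suc a b zero    j       = lemma a b j (choose2 j)
  where
  lemma : ∀ a b j t → (a + b) * (t + j) + a * suc j + (a + b) * 0 ≡ (a + b) * t + a * j + (a + b) * j + a
  lemma = solve-∀
expo-suc a b (suc zero) zero = lemma a b
  where
  lemma : ∀ a b → (a + b) * 0 + a * 0 + (a + b) * 1 ≡ (a + b) * 0 + b * 1 + (a + b) * 0 + a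
  lemma = solve-∀
expo-suc a b (suc (suc m)) zero    = lemma a b m (choose2 m)
  where
  lemma : ∀ a b m t → (a + b) * (t + m) + b * suc m + (a + b) * suc (suc m)
                    ≡ (a + b) * (t + m + suc m) + b * suc (suc m) + (a + b) * 0 + a
  lemma = solve-∀
expo-suc a b (suc m) (suc j) = begin
  expo a b m (suc j) + (a + b) * suc m         ≡⟨ lemma₁ (expo a b m (suc j)) (a + b) m ⟩
  expo a b m (suc j) + (a + b) * m + (a + b)   ≡⟨ cong (_+ (a + b)) (expo-suc a b m j) ⟩
  expo a b m j + (a + b) * j + a + (a + b)     ≡⟨ lemma₂ (expo a b m j) a (a + b) j ⟩
  expo a b m j + (a + b) * suc j + a           ∎
  where
  open ≡-Reasoning
  lemma₁ : ∀ x c m → x + c * suc m ≡ x + c * m + c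
  lemma₁ = solve-∀
  lemma₂ : ∀ x a c j → x + c * j + a + c ≡ x + c * suc j + a
  lemma₂ = solve-∀

-- Exponent bookkeeping for the new factor 1 + q^(a + cn), where c = a + b: the term at `j`, shifted
-- by that factor, is the term at `j + 1` times the power q^(cl) which the q-Pascal rule supplies.
expo-stepʳ : ∀ a b m n j l → j + l ≡ m + n → expo a b m j + (a + (a + b) * n) ≡ expo a b m (suc j) + (a + b) * l
expo-stepʳ a b m n j l e = +-cancelʳ-≡ ((a + b) * m) _ _ (begin
  expo a b m j + (a + (a + b) * n) + (a + b) * m    ≡⟨ lemma₁ (expo a b m j) a (a + b) m n ⟩
  expo a b m j + (a + b) * (m + n) + a              ≡⟨ cong (λ x → expo a b m j + (a + b) * x + a) e ⟨
  expo a b m j + (a + b) * (j + l) + a              ≡⟨ lemma₂ (expo a b m j) a (a + b) j l ⟩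
  expo a b m j + (a + b) * j + a + (a + b) * l      ≡⟨ cong (_+ (a + b) * l) (expo-suc a b m j) ⟨
  expo a b m (suc j) + (a + b) * m + (a + b) * l    ≡⟨ lemma₃ (expo a b m (suc j)) _ _ ⟩
  expo a b m (suc j) + (a + b) * l + (a + b) * m    ∎)
  where
  open ≡-Reasoning
  lemma₁ : ∀ x a c m n → x + (a + c * n) + c * m ≡ x + c * (m + n) + a
  lemma₁ = solve-∀
  lemma₂ : ∀ x a c j l → x + c * (j + l) + a ≡ x + c * j + a + c * l
  lemma₂ = solve-∀
  lemma₃ : ∀ x y z → x + y + z ≡ x + z + y
  lemma₃ = solve-∀

expo-stepˡ : ∀ a b m j → expo a b m j + (b + (a + b) * m) ≡ expo a b (suc m) j + (a + b) * j
expo-stepˡ a b m j = +-cancelʳ-≡ a _ _ (begin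
  expo a b m j + (b + (a + b) * m) + a            ≡⟨ lemma (expo a b m j) a b m ⟩
  expo a b m j + (a + b) * suc m                  ≡⟨ expo-suc a b (suc m) j ⟩
  expo a b (suc m) j + (a + b) * j + a            ∎)
  where
  open ≡-Reasoning
  lemma : ∀ x a b m → x + (b + (a + b) * m) + a ≡ x + (a + b) * suc m
  lemma = solve-∀

-- This and `expo-lowerˡ` together bound |j - m| by the exponent, which controls the tails when the
-- finite identity is truncated.
expo-lowerʳ : ∀ a b → 0 < a → 0 < b → ∀ m j → j ≤ expo a b m j + m
expo-lowerʳ a@(suc _) b 0<a 0<b zero    j       = ≤-trans (m≤n*m j a) (≤-trans (m≤n+m (a * j) ((a + b) * choose2 j)) (m≤m+n _ 0))
expo-lowerʳ a b 0<a 0<b (suc m) zero    = z≤n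
expo-lowerʳ a b 0<a 0<b (suc m) (suc j) = ≤-trans (s≤s (expo-lowerʳ a b 0<a 0<b m j)) (≤-reflexive (sym (+-suc _ m)))

expo-lowerˡ : ∀ a b → 0 < a → 0 < b → ∀ m j → m ≤ expo a b m j + j
expo-lowerˡ a b 0<a 0<b zero    j       = z≤n
expo-lowerˡ a b@(suc _) 0<a 0<b (suc m) zero = ≤-trans (m≤n*m (suc m) b) (≤-trans (m≤n+m (b * suc m) ((a + b) * choose2 (suc m))) (m≤m+n _ 0))
expo-lowerˡ a b 0<a 0<b (suc m) (suc j) = ≤-trans (s≤s (expo-lowerˡ a b 0<a 0<b m j)) (≤-reflexive (sym (+-suc _ j)))

euler⁻¹ : ℕ → ℕ → Series₂
euler⁻¹ c n = prod n (λ i → geom₂ (c + c * i))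

-- The Gaussian binomial [j+l; j] in the base q^c.
gauss : ℕ → ℕ → ℕ → Series₂
gauss c j l = euler c (j + l) ⊠ (euler⁻¹ c j ⊠ euler⁻¹ c l)

module JacobiTriple (N : ℕ) where
  open Trunc N
  open Solver using (solve; _:+_; _:*_; _:=_; con; _:^_)
  open ≈-Reasoning

  prod-inverse : ∀ a c n → 0 < a → prod n (fac a c) ⊠ prod n (λ i → geom₂ (a + c * i)) ≈ 1ˢ
  prod-inverse a c n 0<a = begin
    prod n (fac a c) ⊠ prod n (λ i → geom₂ (a + c * i)) ≈⟨ prod-⊠ n _ _ ⟨
    prod n (λ i → fac a c i ⊠ geom₂ (a + c * i))        ≈⟨ prod-cong n (λ i _ → fac-inverse a c i 0<a) ⟩
    prod n (λ _ → 1ˢ)                                   ≈⟨ prod-1 n ⟩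
    1ˢ                                                  ∎

  ⊠-identityʳ′ : ∀ f → f ⊠ 1ˢ ≈ f
  ⊠-identityʳ′ f = solve 1 (λ f → f :* con true := f) ≈-refl f

  pad : ∀ {u} f → u ≈ 1ˢ → f ≈ f ⊠ u
  pad f p = ≈-trans (≈-sym (⊠-identityʳ′ f)) (⊠-congˡ f (≈-sym p))

  module _ (c : ℕ) (0<c : 0 < c) where

    gauss-0ˡ : ∀ l → gauss c 0 l ≈ 1ˢ
    gauss-0ˡ l = ≈-trans (solve 2 (λ e h → e :* (con true :* h) := e :* h) ≈-refl _ _) (prod-inverse c c l 0<c)

    gauss-0ʳ : ∀ j → gauss c j 0 ≈ 1ˢ
    gauss-0ʳ j rewrite +-identityʳ j =
      ≈-trans (solve 2 (λ e h → e :* (h :* con true) := e :* h) ≈-refl _ _) (prod-inverse c c j 0<c)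

    private
      ↑ : ℕ → Series₂
      ↑ i = mono (c + c * i)

      ↑-+ : ∀ j l → ↑ (suc (j + l)) ≈ ↑ j ⊠ ↑ l
      ↑-+ j l = ≈-trans (≡⇒≈ (cong mono (lemma c j l))) (mono-+ (c + c * j) (c + c * l))
        where
        lemma : ∀ c j l → c + c * suc (j + l) ≡ (c + c * j) + (c + c * l)
        lemma = solve-∀

      top : ∀ j l → euler c (suc j + suc l) ≈ euler c (j + suc l) ⊠ (1ˢ ⊞ ↑ j ⊠ ↑ l)
      top j l = ⊠-congˡ (euler c (j + suc l)) (⊞-cong ≈-refl
        (≈-trans (≡⇒≈ (cong ↑ (+-suc j l))) (↑-+ j l)))

    -- The last factor of the numerator is 1 + xy = (1 + x) + x(1 + y), with x = q^(c(j+1)) and y =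
    -- q^(c(l+1)); each bracket cancels one geometric series of the denominator.
    gauss-pascalʳ : ∀ j l → gauss c (suc j) (suc l) ≈ gauss c j (suc l) ⊞ ↑ j ⊠ gauss c (suc j) l
    gauss-pascalʳ j l = begin
      gauss c (suc j) (suc l)
        ≈⟨ ⊠-congʳ _ (top j l) ⟩
      E ⊠ (1ˢ ⊞ x ⊠ y) ⊠ ((h ⊠ gx) ⊠ (k ⊠ gy))
        ≈⟨ solve 7 (λ E x y h gx k gy →
             E :* (con true :+ x :* y) :* ((h :* gx) :* (k :* gy))
             := E :* (h :* (k :* gy)) :* ((con true :+ x) :* gx)
                :+ x :* (E :* ((h :* gx) :* k) :* ((con true :+ y) :* gy)))
             ≈-refl E x y h gx k gy ⟩
      E ⊠ (h ⊠ (k ⊠ gy)) ⊠ (fac c c j ⊠ gx) ⊞ x ⊠ (E ⊠ ((h ⊠ gx) ⊠ k) ⊠ (fac c c l ⊠ gy))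
        ≈⟨ ⊞-cong (pad _ (fac-inverse c c j 0<c)) (⊠-congˡ x (pad _ (fac-inverse c c l 0<c))) ⟨
      gauss c j (suc l) ⊞ x ⊠ (E ⊠ ((h ⊠ gx) ⊠ k))
        ≈⟨ ⊞-cong ≈-refl (⊠-congˡ x (⊠-congʳ _ (≡⇒≈ (cong (euler c) (+-suc j l))))) ⟩
      gauss c j (suc l) ⊞ ↑ j ⊠ gauss c (suc j) l ∎
      where
      E = euler c (j + suc l)
      x = ↑ j
      y = ↑ l
      h = euler⁻¹ c j
      k = euler⁻¹ c l
      gx = geom₂ (c + c * j)
      gy = geom₂ (c + c * l)

    gauss-comm : ∀ j l → gauss c j l ≈ gauss c l j
    gauss-comm j l = ⊠-cong (≡⇒≈ (cong (euler c) (+-comm j l)))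
      (solve 2 (λ h k → h :* k := k :* h) ≈-refl _ _)

    gauss-pascalˡ : ∀ j l → gauss c (suc j) (suc l) ≈ gauss c (suc j) l ⊞ ↑ l ⊠ gauss c j (suc l)
    gauss-pascalˡ j l = begin
      gauss c (suc j) (suc l)                          ≈⟨ gauss-comm (suc j) (suc l) ⟩
      gauss c (suc l) (suc j)                          ≈⟨ gauss-pascalʳ l j ⟩
      gauss c l (suc j) ⊞ ↑ l ⊠ gauss c (suc l) j      ≈⟨ ⊞-cong (gauss-comm l (suc j)) (⊠-congˡ (↑ l) (gauss-comm (suc l) j)) ⟩
      gauss c (suc j) l ⊞ ↑ l ⊠ gauss c j (suc l)      ∎

  module _ (a b : ℕ) (0<a : 0 < a) (0<b : 0 < b) where
    private
      c = a + b
      0<c : 0 < c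
      0<c = ≤-trans 0<a (m≤m+n a b)

      term : ℕ → ℕ → ℕ → Series₂
      term m j l = gauss c j l ⊠ mono (expo a b m j)

      distrib : ∀ M F q → antidiag M F ⊠ (1ˢ ⊞ q) ≈ antidiag M F ⊞ antidiag M (λ j l → F j l ⊠ q)
      distrib M F q = ≈-trans (solve 2 (λ s q → s :* (con true :+ q) := s :+ s :* q) ≈-refl _ q)
        (⊞-cong ≈-refl (≈-sym (antidiag-⊠ M F q)))

      shift : ∀ g d e f k → d + e ≡ f + c * k → (g ⊠ mono d) ⊠ mono e ≈ mono (c * k) ⊠ g ⊠ mono f
      shift g d e f k eq = begin
        g ⊠ mono d ⊠ mono e            ≈⟨ solve 3 (λ g d e → g :* d :* e := g :* (d :* e)) ≈-refl g _ _ ⟩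
        g ⊠ (mono d ⊠ mono e)          ≈⟨ ⊠-congˡ g (≈-trans (≈-sym (mono-+ d e)) (≈-trans (≡⇒≈ (cong mono eq)) (mono-+ f (c * k)))) ⟩
        g ⊠ (mono f ⊠ mono (c * k))    ≈⟨ solve 3 (λ g d e → g :* (d :* e) := e :* g :* d) ≈-refl g _ _ ⟩
        mono (c * k) ⊠ g ⊠ mono f      ∎

      shift₀ : ∀ g d e f → d + e ≡ f + c * 0 → (g ⊠ mono d) ⊠ mono e ≈ g ⊠ mono f
      shift₀ g d e f eq = begin
        g ⊠ mono d ⊠ mono e            ≈⟨ shift g d e f 0 eq ⟩
        mono (c * 0) ⊠ g ⊠ mono f      ≈⟨ ⊠-congʳ _ (⊠-congʳ g (≡⇒≈ (cong mono (*-zeroʳ c)))) ⟩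
        1ˢ ⊠ g ⊠ mono f                ≈⟨ solve 2 (λ g f → con true :* g :* f := g :* f) ≈-refl g _ ⟩
        g ⊠ mono f                     ∎

      ↑-suc : ∀ k → mono (c + c * k) ≈ mono (c * suc k)
      ↑-suc k = ≡⇒≈ (cong mono (sym (*-suc c k)))

      stepʳ : ∀ m n → antidiag (m + n) (term m) ⊠ fac a c n ≈ antidiag (suc (m + n)) (term m)
      stepʳ m n = ≈-trans (distrib (m + n) (term m) _) (≈-sym (antidiag-merge (m + n) (term m) (term m) _
        (λ l _ → ⊠-congʳ _ (≈-trans (gauss-0ˡ c 0<c (suc l)) (≈-sym (gauss-0ˡ c 0<c l))))
        (λ j l e → begin
          term m (suc j) (suc l)
            ≈⟨ ⊠-congʳ _ (gauss-pascalˡ c 0<c j l) ⟩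
          (gauss c (suc j) l ⊞ mono (c + c * l) ⊠ gauss c j (suc l)) ⊠ mono (expo a b m (suc j))
            ≈⟨ solve 4 (λ g u h x → (g :+ u :* h) :* x := g :* x :+ u :* h :* x) ≈-refl _ _ _ _ ⟩
          term m (suc j) l ⊞ mono (c + c * l) ⊠ gauss c j (suc l) ⊠ mono (expo a b m (suc j))
            ≈⟨ ⊞-cong ≈-refl (⊠-congʳ _ (⊠-congʳ _ (↑-suc l))) ⟩
          term m (suc j) l ⊞ mono (c * suc l) ⊠ gauss c j (suc l) ⊠ mono (expo a b m (suc j))
            ≈⟨ ⊞-cong ≈-refl (shift _ (expo a b m j) (a + c * n) _ (suc l) (expo-stepʳ a b m n j (suc l) (trans (+-suc j l) e))) ⟨
          term m (suc j) l ⊞ term m j (suc l) ⊠ mono (a + c * n) ∎)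
        (λ j e → begin
          term m (suc j) 0                    ≈⟨ ⊠-congʳ _ (≈-trans (gauss-0ʳ c 0<c (suc j)) (≈-sym (gauss-0ʳ c 0<c j))) ⟩
          gauss c j 0 ⊠ mono (expo a b m (suc j))
            ≈⟨ shift₀ _ (expo a b m j) (a + c * n) _ (expo-stepʳ a b m n j 0 (trans (+-identityʳ j) e)) ⟨
          term m j 0 ⊠ mono (a + c * n)       ∎)))

      stepˡ : ∀ m n → antidiag (m + n) (term m) ⊠ fac b c m ≈ antidiag (suc (m + n)) (term (suc m))
      stepˡ m n = begin
        antidiag (m + n) (term m) ⊠ fac b c m
          ≈⟨ distrib (m + n) (term m) _ ⟩
        antidiag (m + n) (term m) ⊞ antidiag (m + n) (λ j l → term m j l ⊠ mono (b + c * m))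
          ≈⟨ solve 2 (λ x y → x :+ y := y :+ x) ≈-refl _ _ ⟩
        antidiag (m + n) (λ j l → term m j l ⊠ mono (b + c * m)) ⊞ antidiag (m + n) (term m)
          ≈⟨ antidiag-merge (m + n) (term (suc m)) _ (term m)
               (λ l _ → begin
                 term (suc m) 0 (suc l)
                   ≈⟨ ⊠-congʳ _ (≈-trans (gauss-0ˡ c 0<c (suc l)) (≈-sym (gauss-0ˡ c 0<c l))) ⟩
                 gauss c 0 l ⊠ mono (expo a b (suc m) 0)
                   ≈⟨ shift₀ _ (expo a b m 0) (b + c * m) _ (expo-stepˡ a b m 0) ⟨
                 term m 0 l ⊠ mono (b + c * m) ∎)
               (λ j l _ → begin
                 term (suc m) (suc j) (suc l)
                   ≈⟨ ⊠-congʳ _ (gauss-pascalʳ c 0<c j l) ⟩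
                 (gauss c j (suc l) ⊞ mono (c + c * j) ⊠ gauss c (suc j) l) ⊠ mono (expo a b m j)
                   ≈⟨ solve 4 (λ g u h x → (g :+ u :* h) :* x := u :* h :* x :+ g :* x) ≈-refl _ _ _ _ ⟩
                 mono (c + c * j) ⊠ gauss c (suc j) l ⊠ mono (expo a b m j) ⊞ term m j (suc l)
                   ≈⟨ ⊞-cong (⊠-congʳ _ (⊠-congʳ _ (↑-suc j))) ≈-refl ⟩
                 mono (c * suc j) ⊠ gauss c (suc j) l ⊠ mono (expo a b m j) ⊞ term m j (suc l)
                   ≈⟨ ⊞-cong (shift _ (expo a b m (suc j)) (b + c * m) _ (suc j) (expo-stepˡ a b m (suc j))) ≈-refl ⟨
                 term m (suc j) l ⊠ mono (b + c * m) ⊞ term m j (suc l) ∎)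
               (λ j _ → ⊠-congʳ _ (≈-trans (gauss-0ʳ c 0<c (suc j)) (≈-sym (gauss-0ʳ c 0<c j)))) ⟨
        antidiag (suc (m + n)) (term (suc m)) ∎

    -- The q-binomial theorem in symmetric form. A new factor on the `a` side needs one q-Pascal
    -- rule and a new factor on the `b` side the other, hence `stepʳ` and `stepˡ`.
    finite-triple-product : ∀ m n → prod m (fac b c) ⊠ prod n (fac a c) ≈ antidiag (m + n) (term m)
    finite-triple-product zero zero = begin
      1ˢ ⊠ 1ˢ                               ≈⟨ ⊠-cong (≈-sym (gauss-0ˡ c 0<c 0)) (≡⇒≈ (cong mono (sym zero-expo))) ⟩
      gauss c 0 0 ⊠ mono (expo a b 0 0)     ∎
      where
      zero-expo : c * 0 + a * 0 ≡ 0
      zero-expo = cong₂ _+_ (*-zeroʳ c) (*-zeroʳ a)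
    finite-triple-product (suc m) zero = begin
      prod m (fac b c) ⊠ fac b c m ⊠ 1ˢ     ≈⟨ solve 2 (λ p f → p :* f :* con true := p :* con true :* f) ≈-refl _ _ ⟩
      prod m (fac b c) ⊠ 1ˢ ⊠ fac b c m     ≈⟨ ⊠-congʳ _ (finite-triple-product m zero) ⟩
      antidiag (m + 0) (term m) ⊠ fac b c m ≈⟨ stepˡ m 0 ⟩
      antidiag (suc m + 0) (term (suc m))   ∎
    finite-triple-product m (suc n) = begin
      prod m (fac b c) ⊠ (prod n (fac a c) ⊠ fac a c n) ≈⟨ solve 3 (λ p q f → p :* (q :* f) := p :* q :* f) ≈-refl _ _ _ ⟩
      prod m (fac b c) ⊠ prod n (fac a c) ⊠ fac a c n   ≈⟨ ⊠-congʳ _ (finite-triple-product m n) ⟩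
      antidiag (m + n) (term m) ⊠ fac a c n             ≈⟨ stepʳ m n ⟩
      antidiag (suc (m + n)) (term m)                   ≈⟨ ≡⇒≈ (cong (λ M → antidiag M (term m)) (sym (+-suc m n))) ⟩
      antidiag (m + suc n) (term m)                     ∎

  -- Behind a factor q^e, a factor 1 + q^r with e + r > N acts as 1.
  prod-stable : ∀ e a c j d → N < e + (a + c * j) → mono e ⊠ prod (j + d) (fac a c) ≈ mono e ⊠ prod j (fac a c)
  prod-stable e a c j zero    N< = ≡⇒≈ (cong (λ n → mono e ⊠ prod n (fac a c)) (+-identityʳ j))
  prod-stable e a c j (suc d) N< = begin
    mono e ⊠ prod (j + suc d) (fac a c)
      ≈⟨ ⊠-congˡ _ (≡⇒≈ (cong (λ n → prod n (fac a c)) (+-suc j d))) ⟩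
    mono e ⊠ (P ⊠ (1ˢ ⊞ mono r))
      ≈⟨ solve 3 (λ e p r → e :* (p :* (con true :+ r)) := e :* p :+ e :* r :* p) ≈-refl _ _ _ ⟩
    mono e ⊠ P ⊞ mono e ⊠ mono r ⊠ P
      ≈⟨ ⊞-cong ≈-refl (≈-trans (⊠-congʳ P (≈-sym (mono-+ e r))) (mono-vanish N<e+r P)) ⟩
    mono e ⊠ P ⊞ 0ˢ
      ≈⟨ solve 1 (λ x → x :+ con false := x) ≈-refl _ ⟩
    mono e ⊠ P
      ≈⟨ prod-stable e a c j d N< ⟩
    mono e ⊠ prod j (fac a c) ∎
    where
    P = prod (j + d) (fac a c)
    r = a + c * (j + d)
    N<e+r : N < e + r
    N<e+r = ≤-trans N< (+-monoʳ-≤ e (+-monoʳ-≤ a (*-monoʳ-≤ c (m≤m+n j d))))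

  prod-stable-≤ : ∀ e a c {j n} → j ≤ n → N < e + (a + c * j) → mono e ⊠ prod n (fac a c) ≈ mono e ⊠ prod j (fac a c)
  prod-stable-≤ e a c {j} j≤n N< with m≤n⇒∃[o]m+o≡n j≤n
  ... | d , refl = prod-stable e a c j d N<

  -- The Gaussian binomial tends to the inverse of `euler c`. Since `l` is at least `N`,
  -- `euler c (j + l)` cancels against `euler⁻¹ c l`. The index `j` may be small, but then q^e is
  -- large: N ≤ e + j pushes the factors between `euler c j` and `euler c N` beyond degree `N`.
  gauss-limit : ∀ c → 0 < c → ∀ e j l → j ≤ N → N ≤ l → N ≤ e + j →
                gauss c j l ⊠ mono e ⊠ euler c N ≈ mono e
  gauss-limit c 0<c e j l j≤N N≤l N≤e+j = begin
    euler c (j + l) ⊠ (H j ⊠ H l) ⊠ mono e ⊠ euler c N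
      ≈⟨ solve 5 (λ E h k x F → E :* (h :* k) :* x :* F := (x :* E) :* k :* h :* F) ≈-refl _ _ _ _ _ ⟩
    (mono e ⊠ euler c (j + l)) ⊠ H l ⊠ H j ⊠ euler c N
      ≈⟨ ⊠-congʳ _ (⊠-congʳ _ (⊠-congʳ _ (prod-stable-≤ e c c (m≤n+m l j) N<₁))) ⟩
    (mono e ⊠ euler c l) ⊠ H l ⊠ H j ⊠ euler c N
      ≈⟨ solve 5 (λ x E k h F → x :* E :* k :* h :* F := (x :* F) :* h :* (E :* k)) ≈-refl _ _ _ _ _ ⟩
    (mono e ⊠ euler c N) ⊠ H j ⊠ (euler c l ⊠ H l)
      ≈⟨ pad _ (prod-inverse c c l 0<c) ⟨
    (mono e ⊠ euler c N) ⊠ H j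
      ≈⟨ ⊠-congʳ _ (prod-stable-≤ e c c j≤N N<₂) ⟩
    (mono e ⊠ euler c j) ⊠ H j
      ≈⟨ solve 3 (λ x y z → x :* y :* z := x :* (y :* z)) ≈-refl _ _ _ ⟩
    mono e ⊠ (euler c j ⊠ H j)
      ≈⟨ pad _ (prod-inverse c c j 0<c) ⟨
    mono e ∎
    where
    H = euler⁻¹ c
    i<c+ci : ∀ i → i < c + c * i
    i<c+ci i = +-mono-≤ 0<c (m≤n*m i c {{>-nonZero 0<c}})
    N<₁ : N < e + (c + c * l)
    N<₁ = ≤-trans (s≤s N≤l) (≤-trans (i<c+ci l) (m≤n+m _ e))
    N<₂ : N < e + (c + c * j)
    N<₂ = ≤-trans (s≤s N≤e+j) (≤-trans (≤-reflexive (sym (+-suc e j))) (+-monoʳ-≤ e (i<c+ci j)))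

  triple-product : ∀ a b → 0 < a → 0 < b →
    prod N (fac b (a + b)) ⊠ prod N (fac a (a + b)) ⊠ euler (a + b) N ≈ antidiag (N + N) (λ j _ → mono (expo a b N j))
  triple-product a b 0<a 0<b = begin
    prod N (fac b c) ⊠ prod N (fac a c) ⊠ euler c N
      ≈⟨ ⊠-congʳ _ (finite-triple-product a b 0<a 0<b N N) ⟩
    antidiag (N + N) (λ j l → gauss c j l ⊠ mono (expo a b N j)) ⊠ euler c N
      ≈⟨ antidiag-⊠ (N + N) _ _ ⟨
    antidiag (N + N) (λ j l → gauss c j l ⊠ mono (expo a b N j) ⊠ euler c N)
      ≈⟨ antidiag-cong (N + N) limit ⟩
    antidiag (N + N) (λ j _ → mono (expo a b N j)) ∎
    where
    c = a + b
    0<c : 0 < c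
    0<c = ≤-trans 0<a (m≤m+n a b)
    limit : ∀ j l → j + l ≡ N + N → gauss c j l ⊠ mono (expo a b N j) ⊠ euler c N ≈ mono (expo a b N j)
    limit j l e with ≤-total j N
    ... | inj₁ j≤N = gauss-limit c 0<c _ j l j≤N (+-cancelˡ-≤ N N l (≤-trans (≤-reflexive (sym e)) (+-monoˡ-≤ l j≤N)))
                       (expo-lowerˡ a b 0<a 0<b N j)
    ... | inj₂ N≤j = ≈-trans (⊠-congʳ _ (⊠-congʳ _ (gauss-comm c 0<c j l)))
                       (gauss-limit c 0<c _ l j (+-cancelˡ-≤ N l N (≤-trans (+-monoˡ-≤ l N≤j) (≤-reflexive e))) N≤j
                         (+-cancelʳ-≤ N N _ (≤-trans (≤-reflexive (sym e)) (≤-trans (+-monoˡ-≤ l (expo-lowerʳ a b 0<a 0<b N j))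
                           (≤-reflexive (lemma (expo a b N j) N l))))))
      where
      lemma : ∀ x n l → x + n + l ≡ x + l + n
      lemma = solve-∀

-- Theta series as sums over ℤ

expoℤ : ℕ → ℕ → ℤ → ℕ
expoℤ a b (+ k)    = (a + b) * choose2 k + a * k
expoℤ a b -[1+ k ] = (a + b) * choose2 (suc k) + b * suc k

expo≡expoℤ : ∀ a b m j → expo a b m j ≡ expoℤ a b (j ⊖ m)
expo≡expoℤ a b zero    j       = refl
expo≡expoℤ a b (suc m) zero    = refl
expo≡expoℤ a b (suc m) (suc j) = trans (expo≡expoℤ a b m j) (cong (expoℤ a b) (sym (ℤ.[1+m]⊖[1+n]≡m⊖n j m)))

∣k∣≤expoℤ : ∀ a b → 0 < a → 0 < b → ∀ k → ∣ k ∣ ≤ expoℤ a b k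
∣k∣≤expoℤ a@(suc _) b _ _ (+ k)    = ≤-trans (m≤n*m k a) (m≤n+m (a * k) ((a + b) * choose2 k))
∣k∣≤expoℤ a b@(suc _) _ _ -[1+ k ] = ≤-trans (m≤n*m (suc k) b) (m≤n+m (b * suc k) ((a + b) * choose2 (suc k)))

2*choose2 : ∀ k → 2 * choose2 k + k ≡ k * k
2*choose2 zero    = refl
2*choose2 (suc k) = begin
  2 * (choose2 k + k) + suc k       ≡⟨ lemma₁ (choose2 k) k ⟩
  2 * choose2 k + k + (2 * k + 1) ≡⟨ cong (_+ (2 * k + 1)) (2*choose2 k) ⟩
  k * k + (2 * k + 1)             ≡⟨ lemma₂ k ⟩
  suc k * suc k                         ∎
  where
  open ≡-Reasoning
  lemma₁ : ∀ t k → 2 * (t + k) + suc k ≡ 2 * t + k + (2 * k + 1)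
  lemma₁ = solve-∀
  lemma₂ : ∀ k → k * k + (2 * k + 1) ≡ suc k * suc k
  lemma₂ = solve-∀

-- Doubling clears the triangular numbers and gives one polynomial for both signs of `k`; all
-- comparisons of weights go through it.
2*expoℤ : ∀ a b k → + 2 ℤ.* + expoℤ a b k ≡ (+ a ℤ.+ + b) ℤ.* (k ℤ.* k) ℤ.+ (+ a ℤ.- + b) ℤ.* k
2*expoℤ a b k = go k
  where
  open ≡-Reasoning
  cast : ∀ c x n → + (c * choose2 n + x * n) ≡ + c ℤ.* + choose2 n ℤ.+ + x ℤ.* + n
  cast c x n = trans (ℤ.pos-+ (c * choose2 n) _) (cong₂ ℤ._+_ (ℤ.pos-* c _) (ℤ.pos-* x n))
  square : ∀ n → + 2 ℤ.* + choose2 n ℤ.+ + n ≡ + n ℤ.* + n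
  square n = begin
    + 2 ℤ.* + choose2 n ℤ.+ + n     ≡⟨ cong (ℤ._+ + n) (ℤ.pos-* 2 (choose2 n)) ⟨
    + (2 * choose2 n) ℤ.+ + n     ≡⟨ ℤ.pos-+ (2 * choose2 n) n ⟨
    + (2 * choose2 n + n)       ≡⟨ cong +_ (2*choose2 n) ⟩
    + (n * n)                     ≡⟨ ℤ.pos-* n n ⟩
    + n ℤ.* + n                     ∎
  lemma₁ : ∀ c x t n → + 2 ℤ.* (c ℤ.* t ℤ.+ x ℤ.* n) ≡ c ℤ.* (+ 2 ℤ.* t ℤ.+ n) ℤ.+ (+ 2 ℤ.* x ℤ.- c) ℤ.* n
  lemma₁ = ℤ.solve-∀
  double : ∀ c x n → + 2 ℤ.* + (c * choose2 n + x * n) ≡ + c ℤ.* (+ n ℤ.* + n) ℤ.+ (+ 2 ℤ.* + x ℤ.- + c) ℤ.* + n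
  double c x n = begin
    + 2 ℤ.* + (c * choose2 n + x * n)
      ≡⟨ cong (+ 2 ℤ.*_) (cast c x n) ⟩
    + 2 ℤ.* (+ c ℤ.* + choose2 n ℤ.+ + x ℤ.* + n)
      ≡⟨ lemma₁ (+ c) (+ x) (+ choose2 n) (+ n) ⟩
    + c ℤ.* (+ 2 ℤ.* + choose2 n ℤ.+ + n) ℤ.+ (+ 2 ℤ.* + x ℤ.- + c) ℤ.* + n
      ≡⟨ cong (λ s → + c ℤ.* s ℤ.+ (+ 2 ℤ.* + x ℤ.- + c) ℤ.* + n) (square n) ⟩
    + c ℤ.* (+ n ℤ.* + n) ℤ.+ (+ 2 ℤ.* + x ℤ.- + c) ℤ.* + n ∎
  plus : ∀ a b n → (a ℤ.+ b) ℤ.* (n ℤ.* n) ℤ.+ (+ 2 ℤ.* a ℤ.- (a ℤ.+ b)) ℤ.* n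
                 ≡ (a ℤ.+ b) ℤ.* (n ℤ.* n) ℤ.+ (a ℤ.- b) ℤ.* n
  plus = ℤ.solve-∀
  minus : ∀ a b n → (a ℤ.+ b) ℤ.* (n ℤ.* n) ℤ.+ (+ 2 ℤ.* b ℤ.- (a ℤ.+ b)) ℤ.* n
                  ≡ (a ℤ.+ b) ℤ.* (ℤ.- n ℤ.* ℤ.- n) ℤ.+ (a ℤ.- b) ℤ.* ℤ.- n
  minus = ℤ.solve-∀
  go : ∀ k → + 2 ℤ.* + expoℤ a b k ≡ (+ a ℤ.+ + b) ℤ.* (k ℤ.* k) ℤ.+ (+ a ℤ.- + b) ℤ.* k
  go (+ n)    = trans (double (a + b) a n) (plus (+ a) (+ b) (+ n))
  go -[1+ n ] = trans (double (a + b) b (suc n)) (minus (+ a) (+ b) (+ suc n))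

lsum : {A : Set} → (A → Series₂) → List A → Series₂
lsum f []       = 0ˢ
lsum f (x ∷ xs) = f x ⊞ lsum f xs

window : ℕ → List ℤ
window N = applyUpTo (_⊖ N) (suc (N + N))

⊖-injectiveˡ : ∀ {i j} n → i ⊖ n ≡ j ⊖ n → i ≡ j
⊖-injectiveˡ {i} {j} n e = ℤ.+-injective (trans (sym (restore i)) (trans (cong (ℤ._+ + n) e) (restore j)))
  where
  lemma : ∀ x y → (x ℤ.+ ℤ.- y) ℤ.+ y ≡ x
  lemma = ℤ.solve-∀
  restore : ∀ m → (m ⊖ n) ℤ.+ + n ≡ + m
  restore m = trans (cong (ℤ._+ + n) (sym (ℤ.m-n≡m⊖n m n))) (lemma (+ m) (+ n))

window-unique : ∀ N → Unique (window N)
window-unique N = Unique.applyUpTo⁺₁ _ _ λ i<j _ e → <⇒≢ i<j (⊖-injectiveˡ N e)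

∈-window : ∀ N k → ∣ k ∣ ≤ N → k ∈ window N
∈-window N (+ n) n≤N = subst (_∈ window N) eq (∈-applyUpTo⁺ (_⊖ N) (s≤s (+-monoʳ-≤ N n≤N)))
  where
  eq : (N + n) ⊖ N ≡ + n
  eq = trans (cong ((N + n) ⊖_) (sym (+-identityʳ N))) (ℤ.+-cancelˡ-⊖ N n 0)
∈-window N -[1+ n ] n<N with m≤n⇒∃[o]m+o≡n n<N
... | o , refl = subst (_∈ window N) eq (∈-applyUpTo⁺ (_⊖ N) (s≤s (≤-trans (m≤n+m o (suc n)) (m≤m+n N N))))
  where
  eq : o ⊖ (suc n + o) ≡ -[1+ n ]
  eq = trans (cong₂ _⊖_ (sym (+-identityʳ o)) (+-comm (suc n) o)) (ℤ.+-cancelˡ-⊖ o 0 (suc n))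

-- Ramanujan's f(q^a, q^b) modulo q^(N+1): for positive `a` and `b` the exponent is at least |k|, so
-- the window -N ≤ k ≤ N misses no term of degree at most `N`.
Θ : ℕ → ℕ → ℕ → Series₂
Θ a b N = lsum (mono ∘ expoℤ a b) (window N)

-- Sums of monomials over lists and their reindexing.

module Lists (N : ℕ) where
  open Trunc N
  open Solver using (solve; _:+_; _:*_; _:=_; con; _:^_)

  antidiag-lsum : ∀ {A : Set} M (f : A → Series₂) h → antidiag M (λ j _ → f (h j)) ≈ lsum f (applyUpTo h (suc M))
  antidiag-lsum zero    f h = ≈-sym (pointwise λ i → trans (⊞-comm _ _ i) (⊞-identityˡ _ i))
  antidiag-lsum (suc M) f h = ⊞-cong ≈-refl (antidiag-lsum M f (h ∘ suc))

  theta-product : ∀ a b → 0 < a → 0 < b →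
    prod N (fac b (a + b)) ⊠ prod N (fac a (a + b)) ⊠ euler (a + b) N ≈ Θ a b N
  theta-product a b 0<a 0<b = ≈-trans (JacobiTriple.triple-product N a b 0<a 0<b)
    (≈-trans (antidiag-cong (N + N) λ j _ _ → ≡⇒≈ (cong mono (expo≡expoℤ a b N j)))
      (antidiag-lsum (N + N) (mono ∘ expoℤ a b) (_⊖ N)))

  lsum-++ : ∀ {A : Set} (f : A → Series₂) xs ys → lsum f (xs ++ ys) ≈ lsum f xs ⊞ lsum f ys
  lsum-++ f []       ys = ≈-sym (pointwise (⊞-identityˡ _))
  lsum-++ f (x ∷ xs) ys = ≈-trans (⊞-cong ≈-refl (lsum-++ f xs ys)) (≈-sym (pointwise (⊞-assoc _ _ _)))

  lsum-cong : ∀ {A : Set} {f g : A → Series₂} → (∀ x → f x ≈ g x) → ∀ xs → lsum f xs ≈ lsum g xs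
  lsum-cong p []       = ≈-refl
  lsum-cong p (x ∷ xs) = ⊞-cong (p x) (lsum-cong p xs)

  lsum-map : ∀ {A B : Set} (f : B → Series₂) (g : A → B) xs → lsum f (map g xs) ≡ lsum (f ∘ g) xs
  lsum-map f g []       = refl
  lsum-map f g (x ∷ xs) = cong (f (g x) ⊞_) (lsum-map f g xs)

  lsum-⊠ˡ : ∀ {A : Set} h (f : A → Series₂) xs → lsum (λ x → h ⊠ f x) xs ≈ h ⊠ lsum f xs
  lsum-⊠ˡ h f []       = solve 1 (λ h → con false := h :* con false) ≈-refl h
  lsum-⊠ˡ h f (x ∷ xs) = ≈-trans (⊞-cong ≈-refl (lsum-⊠ˡ h f xs))
    (solve 3 (λ h a b → h :* a :+ h :* b := h :* (a :+ b)) ≈-refl h _ _)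

  lsum-product : ∀ {A B : Set} (f : A → Series₂) (g : B → Series₂) xs ys →
    lsum (λ (x , y) → f x ⊠ g y) (cartesianProduct xs ys) ≈ lsum f xs ⊠ lsum g ys
  lsum-product f g []       ys = ≈-sym (pointwise (⊠-zeroˡ _))
  lsum-product f g (x ∷ xs) ys = begin
    lsum fg (map (x ,_) ys ++ cartesianProduct xs ys)
      ≈⟨ lsum-++ fg (map (x ,_) ys) _ ⟩
    lsum fg (map (x ,_) ys) ⊞ lsum fg (cartesianProduct xs ys)
      ≈⟨ ⊞-cong (≈-trans (≡⇒≈ (lsum-map fg (x ,_) ys)) (lsum-⊠ˡ (f x) g ys)) (lsum-product f g xs ys) ⟩
    f x ⊠ lsum g ys ⊞ lsum f xs ⊠ lsum g ys
      ≈⟨ pointwise (⊠-distribʳ _ _ _) ⟨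
    lsum f (x ∷ xs) ⊠ lsum g ys ∎
    where
    open ≈-Reasoning
    fg = λ (x , y) → f x ⊠ g y

  lsum-↭ : ∀ {A : Set} (f : A → Series₂) {xs ys} → xs ↭ ys → lsum f xs ≈ lsum f ys
  lsum-↭ f ↭.refl          = ≈-refl
  lsum-↭ f (↭.prep x p)    = ⊞-cong ≈-refl (lsum-↭ f p)
  lsum-↭ f (↭.swap x y p)  = ≈-trans (⊞-cong ≈-refl (⊞-cong ≈-refl (lsum-↭ f p)))
    (solve 3 (λ x y s → x :+ (y :+ s) := y :+ (x :+ s)) ≈-refl (f x) (f y) _)
  lsum-↭ f (↭.trans p q)   = ≈-trans (lsum-↭ f p) (lsum-↭ f q)

  lsum-filter : ∀ {A : Set} (w : A → ℕ) xs →
    lsum (mono ∘ w) xs ≈ lsum (mono ∘ w) (filter (λ x → w x ≤? N) xs)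
  lsum-filter w []       = ≈-refl
  lsum-filter w (x ∷ xs) with w x ≤? N
  ... | yes wx≤N = ≈-trans (⊞-cong ≈-refl (lsum-filter w xs))
                    (≡⇒≈ (cong (lsum (mono ∘ w)) (sym (filter-accept (λ x → w x ≤? N) wx≤N))))
  ... | no wx≰N = ≈-trans (⊞-cong (agree λ i i≤N → mono-above (w x) i (≤-<-trans i≤N (≰⇒> wx≰N))) (lsum-filter w xs))
                    (≈-trans (pointwise (⊞-identityˡ _))
                      (≡⇒≈ (cong (lsum (mono ∘ w)) (sym (filter-reject (λ x → w x ≤? N) wx≰N)))))

  -- The bijection need not carry one finite list onto the other. After dropping all weights above
  -- `N`, invisible modulo q^(N+1), it does; and duplicate-free lists with the same members are
  -- permutations of each other.
  lsum-reindex : ∀ {A B : Set} (w : A → ℕ) (v : B → ℕ) (f : A → B) (g : B → A) {xs ys} →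
    (∀ x → g (f x) ≡ x) → (∀ y → f (g y) ≡ y) → (∀ x → v (f x) ≡ w x) →
    Unique xs → Unique ys → (∀ x → w x ≤ N → x ∈ xs) → (∀ y → v y ≤ N → y ∈ ys) →
    lsum (mono ∘ w) xs ≈ lsum (mono ∘ v) ys
  lsum-reindex {A} {B} w v f g {xs} {ys} gf fg vf xs! ys! xs-all ys-all = begin
    lsum (mono ∘ w) xs                ≈⟨ lsum-filter w xs ⟩
    lsum (mono ∘ w) xs′               ≈⟨ lsum-cong (λ x → ≡⇒≈ (cong mono (sym (vf x)))) xs′ ⟩
    lsum (mono ∘ v ∘ f) xs′           ≈⟨ ≡⇒≈ (lsum-map (mono ∘ v) f xs′) ⟨
    lsum (mono ∘ v) (map f xs′)       ≈⟨ lsum-↭ (mono ∘ v) (∼bag⇒↭ (unique∧set⇒bag map! filter! (mk⇔ to from))) ⟩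
    lsum (mono ∘ v) ys′               ≈⟨ lsum-filter v ys ⟨
    lsum (mono ∘ v) ys                ∎
    where
    open ≈-Reasoning
    small-w = λ x → w x ≤? N
    small-v = λ y → v y ≤? N
    xs′ = filter small-w xs
    ys′ = filter small-v ys
    map! : Unique (map f xs′)
    map! = Unique.map⁺ (λ e → trans (sym (gf _)) (trans (cong g e) (gf _))) (Unique.filter⁺ small-w xs!)
    filter! : Unique ys′
    filter! = Unique.filter⁺ small-v ys!
    to : ∀ {y} → y ∈ map f xs′ → y ∈ ys′
    to y∈ with ∈-map⁻ f y∈
    ... | x , x∈ , refl = ∈-filter⁺ small-v (ys-all (f x) fx≤N) fx≤N
      where fx≤N = subst (_≤ N) (sym (vf x)) (proj₂ (∈-filter⁻ small-w {xs = xs} x∈))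
    from : ∀ {y} → y ∈ ys′ → y ∈ map f xs′
    from {y} y∈ = subst (_∈ map f xs′) (fg y) (∈-map⁺ f (∈-filter⁺ small-w (xs-all (g y) gy≤N) gy≤N))
      where
      gy≤N : w (g y) ≤ N
      gy≤N = subst (_≤ N) (trans (cong v (sym (fg y))) (vf (g y))) (proj₂ (∈-filter⁻ small-v {xs = ys} y∈))

-- The lattice identity

join : ∀ d → Fin d × ℤ → ℤ
join d (r , x) = + toℕ r ℤ.+ x ℤ.* + d

split : ∀ d .{{_ : NonZero d}} → ℤ → Fin d × ℤ
split d z = fromℕ< (ℤ.n%ℕd<d z d) , z ℤ./ℕ d

join-split : ∀ d .{{_ : NonZero d}} z → join d (split d z) ≡ z
join-split d z = trans (cong (λ r → + r ℤ.+ z ℤ./ℕ d ℤ.* + d) (toℕ-fromℕ< (ℤ.n%ℕd<d z d)))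
                       (sym (ℤ.a≡a%ℕn+[a/ℕn]*n z d))

-- Uniqueness of division with remainder: the difference of the remainders is a multiple of `d` of
-- absolute value below `d`.
join-injective : ∀ d {p q : Fin d × ℤ} → join d p ≡ join d q → p ≡ q
join-injective d {r , x} {s , y} e = cong₂ _,_ (toℕ-injective r≡s) x≡y
  where
  lemma : ∀ r x s y d → (r ℤ.+ x ℤ.* d) ≡ (s ℤ.+ y ℤ.* d) → r ℤ.- s ≡ (y ℤ.- x) ℤ.* d
  lemma r x s y d e = trans (lemma₁ r x s y d) (trans (cong (λ z → z ℤ.- s ℤ.- x ℤ.* d) e) (lemma₂ s x y d))
    where
    lemma₁ : ∀ r x s y d → r ℤ.- s ≡ r ℤ.+ x ℤ.* d ℤ.- s ℤ.- x ℤ.* d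
    lemma₁ = ℤ.solve-∀
    lemma₂ : ∀ s x y d → s ℤ.+ y ℤ.* d ℤ.- s ℤ.- x ℤ.* d ≡ (y ℤ.- x) ℤ.* d
    lemma₂ = ℤ.solve-∀
  diff : toℕ r ⊖ toℕ s ≡ (y ℤ.- x) ℤ.* + d
  diff = trans (sym (ℤ.m-n≡m⊖n (toℕ r) (toℕ s))) (lemma (+ toℕ r) x (+ toℕ s) y (+ d) e)
  ∣⊖∣<d : ∣ toℕ r ⊖ toℕ s ∣ < d
  ∣⊖∣<d = ≤-<-trans (ℤ.∣m⊝n∣≤m⊔n (toℕ r) (toℕ s)) (⊔-lub (toℕ<n r) (toℕ<n s))
  y-x≡0 : y ℤ.- x ≡ + 0
  y-x≡0 with ∣ y ℤ.- x ∣ in eq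
  ... | zero  = ℤ.∣i∣≡0⇒i≡0 eq
  ... | suc k = contradiction ∣⊖∣<d (≤⇒≯ (≤-trans (m≤n*m d (suc k))
    (≤-reflexive (sym (trans (cong ∣_∣ diff) (trans (ℤ.abs-* (y ℤ.- x) (+ d)) (cong (_* d) eq)))))))
  x≡y : x ≡ y
  x≡y = sym (ℤ.i-j≡0⇒i≡j y x y-x≡0)
  r≡s : toℕ r ≡ toℕ s
  r≡s = ℤ.+-injective (ℤ.i-j≡0⇒i≡j (+ toℕ r) (+ toℕ s)
    (trans (lemma (+ toℕ r) x (+ toℕ s) y (+ d) e) (cong (ℤ._* + d) y-x≡0)))

split-join : ∀ d .{{_ : NonZero d}} p → split d (join d p) ≡ p
split-join d p = join-injective d (join-split d (join d p))

-- (a , b) ↦ (4a − 1) + (4b − 1)i is a Gaussian integer of norm 8·expo + 2; residues of 2a + b mod 5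
-- detect divisibility by 1 − 2i (residue 2), and otherwise name the unit u for which u(1 + 2i)z
-- has the shape (10m − 3) + (10n − 1)i.
Coset : Set
Coset = Fin 5 × ℤ × ℤ

-- Solves 2a + b = 5x + r for `b`, with y = a. In the coordinates `x`, `y` the bijection needs no
-- division by 5.
fromCoset : Coset → ℤ × ℤ
fromCoset (r , x , y) = y , join 5 (r , x) ℤ.- + 2 ℤ.* y

toCoset : ℤ × ℤ → Coset
toCoset (a , b) = proj₁ (split 5 (+ 2 ℤ.* a ℤ.+ b)) , proj₂ (split 5 (+ 2 ℤ.* a ℤ.+ b)) , a

fromCoset-toCoset : ∀ p → fromCoset (toCoset p) ≡ p
fromCoset-toCoset (a , b) = cong (a ,_) (trans (cong (ℤ._- + 2 ℤ.* a) (join-split 5 (+ 2 ℤ.* a ℤ.+ b))) (lemma a b))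
  where
  lemma : ∀ a b → + 2 ℤ.* a ℤ.+ b ℤ.- + 2 ℤ.* a ≡ b
  lemma = ℤ.solve-∀

toCoset-fromCoset : ∀ c → toCoset (fromCoset c) ≡ c
toCoset-fromCoset (r , x , y) = cong (λ (s , z) → s , z , y)
  (trans (cong (split 5) (lemma (join 5 (r , x)) y)) (split-join 5 (r , x)))
  where
  lemma : ∀ j y → + 2 ℤ.* y ℤ.+ (j ℤ.- + 2 ℤ.* y) ≡ j
  lemma = ℤ.solve-∀

Target : Set
Target = (ℤ × ℤ) ⊎ (ℤ × ℤ)

-- For z = A + Bi the product (1 + 2i)z is (A - 2B) + (2A + B)i; the unit u is -i, -1, 1, i for the
-- residues 0, 1, 3, 4, and solving for m and n gives the entries. For residue 2, iz is (1 - 2i)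
-- times the conjugate of (4c - 1) + (4d - 1)i.
toTarget : Coset → Target
toTarget (0F , x , y) = inj₁ (join 2 (0F , x) , join 2 (0F , + 2 ℤ.* x ℤ.- y))
toTarget (1F , x , y) = inj₁ (join 2 (1F , + 2 ℤ.* x ℤ.- y) , join 2 (0F , ℤ.- x))
toTarget (2F , x , y) = inj₂ (ℤ.- x , + 1 ℤ.+ + 2 ℤ.* x ℤ.- y)
toTarget (3F , x , y) = inj₁ (join 2 (0F , y ℤ.- + 2 ℤ.* x ℤ.- + 1) , join 2 (1F , x))
toTarget (4F , x , y) = inj₁ (join 2 (1F , ℤ.- x ℤ.- + 1) , join 2 (1F , y ℤ.- + 2 ℤ.* x ℤ.- + 2))

-- The four units correspond to the four parity classes of (m, n), so the parities tell which
-- residue modulo 5 to restore.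
fromTarget₁ : Fin 2 × ℤ → Fin 2 × ℤ → Coset
fromTarget₁ (0F , s) (0F , t) = 0F , s , + 2 ℤ.* s ℤ.- t
fromTarget₁ (1F , s) (0F , t) = 1F , ℤ.- t , ℤ.- s ℤ.- + 2 ℤ.* t
fromTarget₁ (0F , s) (1F , t) = 3F , t , s ℤ.+ + 2 ℤ.* t ℤ.+ + 1
fromTarget₁ (1F , s) (1F , t) = 4F , ℤ.- s ℤ.- + 1 , t ℤ.- + 2 ℤ.* s

fromTarget : Target → Coset
fromTarget (inj₁ (m , n)) = fromTarget₁ (split 2 m) (split 2 n)
fromTarget (inj₂ (c , d)) = 2F , ℤ.- c , + 1 ℤ.- + 2 ℤ.* c ℤ.- d

private
  pair : ∀ {A B : Set} {a a′ : A} {b b′ : B} → a ≡ a′ → b ≡ b′ → (a , b) ≡ (a′ , b′)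
  pair = cong₂ _,_

fromTarget-join : ∀ p q → fromTarget (inj₁ (join 2 p , join 2 q)) ≡ fromTarget₁ p q
fromTarget-join p q = cong₂ fromTarget₁ (split-join 2 p) (split-join 2 q)

fromTarget-toTarget : ∀ c → fromTarget (toTarget c) ≡ c
fromTarget-toTarget (0F , x , y) = trans (fromTarget-join (0F , x) (0F , + 2 ℤ.* x ℤ.- y))
  (cong (λ z → 0F , x , z) (lemma x y))
  where
  lemma : ∀ x y → + 2 ℤ.* x ℤ.- (+ 2 ℤ.* x ℤ.- y) ≡ y
  lemma = ℤ.solve-∀
fromTarget-toTarget (1F , x , y) = trans (fromTarget-join (1F , + 2 ℤ.* x ℤ.- y) (0F , ℤ.- x))
  (cong (1F ,_) (pair (ℤ.neg-involutive x) (lemma x y)))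
  where
  lemma : ∀ x y → ℤ.- (+ 2 ℤ.* x ℤ.- y) ℤ.- + 2 ℤ.* (ℤ.- x) ≡ y
  lemma = ℤ.solve-∀
fromTarget-toTarget (2F , x , y) = cong (2F ,_) (pair (ℤ.neg-involutive x) (lemma x y))
  where
  lemma : ∀ x y → + 1 ℤ.- + 2 ℤ.* (ℤ.- x) ℤ.- (+ 1 ℤ.+ + 2 ℤ.* x ℤ.- y) ≡ y
  lemma = ℤ.solve-∀
fromTarget-toTarget (3F , x , y) = trans (fromTarget-join (0F , y ℤ.- + 2 ℤ.* x ℤ.- + 1) (1F , x))
  (cong (λ z → 3F , x , z) (lemma x y))
  where
  lemma : ∀ x y → (y ℤ.- + 2 ℤ.* x ℤ.- + 1) ℤ.+ + 2 ℤ.* x ℤ.+ + 1 ≡ y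
  lemma = ℤ.solve-∀
fromTarget-toTarget (4F , x , y) = trans (fromTarget-join (1F , ℤ.- x ℤ.- + 1) (1F , y ℤ.- + 2 ℤ.* x ℤ.- + 2))
  (cong (4F ,_) (pair (lemma₁ x) (lemma₂ x y)))
  where
  lemma₁ : ∀ x → ℤ.- (ℤ.- x ℤ.- + 1) ℤ.- + 1 ≡ x
  lemma₁ = ℤ.solve-∀
  lemma₂ : ∀ x y → y ℤ.- + 2 ℤ.* x ℤ.- + 2 ℤ.- + 2 ℤ.* (ℤ.- x ℤ.- + 1) ≡ y
  lemma₂ = ℤ.solve-∀

toTarget-fromTarget₁ : ∀ p q → toTarget (fromTarget₁ p q) ≡ inj₁ (join 2 p , join 2 q)
toTarget-fromTarget₁ (0F , s) (0F , t) = cong inj₁ (pair refl (cong (λ z → join 2 (0F , z)) (lemma s t)))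
  where
  lemma : ∀ s t → + 2 ℤ.* s ℤ.- (+ 2 ℤ.* s ℤ.- t) ≡ t
  lemma = ℤ.solve-∀
toTarget-fromTarget₁ (1F , s) (0F , t) = cong inj₁ (pair (cong (λ z → join 2 (1F , z)) (lemma s t))
                                                         (cong (λ z → join 2 (0F , z)) (ℤ.neg-involutive t)))
  where
  lemma : ∀ s t → + 2 ℤ.* (ℤ.- t) ℤ.- (ℤ.- s ℤ.- + 2 ℤ.* t) ≡ s
  lemma = ℤ.solve-∀
toTarget-fromTarget₁ (0F , s) (1F , t) = cong inj₁ (pair (cong (λ z → join 2 (0F , z)) (lemma s t)) refl)
  where
  lemma : ∀ s t → s ℤ.+ + 2 ℤ.* t ℤ.+ + 1 ℤ.- + 2 ℤ.* t ℤ.- + 1 ≡ s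
  lemma = ℤ.solve-∀
toTarget-fromTarget₁ (1F , s) (1F , t) = cong inj₁ (pair (cong (λ z → join 2 (1F , z)) (lemma₁ s))
                                                         (cong (λ z → join 2 (1F , z)) (lemma₂ s t)))
  where
  lemma₁ : ∀ s → ℤ.- (ℤ.- s ℤ.- + 1) ℤ.- + 1 ≡ s
  lemma₁ = ℤ.solve-∀
  lemma₂ : ∀ s t → t ℤ.- + 2 ℤ.* s ℤ.- + 2 ℤ.* (ℤ.- s ℤ.- + 1) ℤ.- + 2 ≡ t
  lemma₂ = ℤ.solve-∀

toTarget-fromTarget : ∀ y → toTarget (fromTarget y) ≡ y
toTarget-fromTarget (inj₁ (m , n)) = trans (toTarget-fromTarget₁ (split 2 m) (split 2 n))
  (cong inj₁ (pair (join-split 2 m) (join-split 2 n)))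
toTarget-fromTarget (inj₂ (c , d)) = cong inj₂ (pair (ℤ.neg-involutive c) (lemma c d))
  where
  lemma : ∀ c d → + 1 ℤ.+ + 2 ℤ.* (ℤ.- c) ℤ.- (+ 1 ℤ.- + 2 ℤ.* c ℤ.- d) ≡ d
  lemma = ℤ.solve-∀

sourceWeight : ℤ × ℤ → ℕ
sourceWeight (a , b) = expoℤ 1 3 a + expoℤ 1 3 b

-- Norms are multiplied or divided by 5. In the first case 5(8w + 2) = (10m - 3)² + (10n - 1)². In
-- the second 8w + 2 = 5(8w′ + 2), so w = 5w′ + 1: hence the `suc` and the parameters 5 and 15.
targetWeight : Target → ℕ
targetWeight (inj₁ (m , n)) = expoℤ 1 4 m + expoℤ 2 3 n
targetWeight (inj₂ (c , d)) = suc (expoℤ 5 15 c + expoℤ 5 15 d)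

quad : ℤ → ℤ → ℤ → ℤ
quad c δ k = c ℤ.* (k ℤ.* k) ℤ.+ δ ℤ.* k

double-weight : ∀ a b a′ b′ k l → + 2 ℤ.* + (expoℤ a b k + expoℤ a′ b′ l)
                ≡ quad (+ a ℤ.+ + b) (+ a ℤ.- + b) k ℤ.+ quad (+ a′ ℤ.+ + b′) (+ a′ ℤ.- + b′) l
double-weight a b a′ b′ k l = begin
  + 2 ℤ.* + (expoℤ a b k + expoℤ a′ b′ l)                ≡⟨ cong (+ 2 ℤ.*_) (ℤ.pos-+ (expoℤ a b k) _) ⟩
  + 2 ℤ.* (+ expoℤ a b k ℤ.+ + expoℤ a′ b′ l)              ≡⟨ ℤ.*-distribˡ-+ (+ 2) (+ expoℤ a b k) _ ⟩
  + 2 ℤ.* + expoℤ a b k ℤ.+ + 2 ℤ.* + expoℤ a′ b′ l        ≡⟨ cong₂ ℤ._+_ (2*expoℤ a b k) (2*expoℤ a′ b′ l) ⟩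
  quad (+ a ℤ.+ + b) (+ a ℤ.- + b) k ℤ.+ quad (+ a′ ℤ.+ + b′) (+ a′ ℤ.- + b′) l ∎
  where open ≡-Reasoning

private
  halve : ∀ {m n} → + 2 ℤ.* + m ≡ + 2 ℤ.* + n → m ≡ n
  halve {m} {n} e = ℤ.+-injective (ℤ.*-cancelˡ-≡ (+ 2) (+ m) (+ n) e)

-- The constants are the values of a + b and a - b in `2*expoℤ`: 4 and -2 for (1, 3), and below 5
-- and -3 for (1, 4), 5 and -1 for (2, 3), 20 and -10 for (5, 15).
doubleSource : ℤ × ℤ → ℤ
doubleSource (a , b) = quad (+ 4) -[1+ 1 ] a ℤ.+ quad (+ 4) -[1+ 1 ] b

doubleTarget : Target → ℤ
doubleTarget (inj₁ (m , n)) = quad (+ 5) -[1+ 2 ] m ℤ.+ quad (+ 5) -[1+ 0 ] n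
doubleTarget (inj₂ (c , d)) = + 2 ℤ.+ (quad (+ 20) -[1+ 9 ] c ℤ.+ quad (+ 20) -[1+ 9 ] d)

2*targetWeight : ∀ t → + 2 ℤ.* + targetWeight t ≡ doubleTarget t
2*targetWeight (inj₁ (m , n)) = double-weight 1 4 2 3 m n
2*targetWeight (inj₂ (c , d)) = trans (ℤ.*-distribˡ-+ (+ 2) (+ 1) (+ (expoℤ 5 15 c + expoℤ 5 15 d)))
  (cong (λ z → + 2 ℤ.+ z) (double-weight 5 15 5 15 c d))

-- After doubling, one polynomial identity in `x` and `y` for each residue.
weights : ∀ z → sourceWeight (fromCoset z) ≡ targetWeight (toTarget z)
weights z@(r , x , y) = halve (trans (double-weight 1 3 1 3 (proj₁ (fromCoset z)) (proj₂ (fromCoset z)))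
  (trans (go r) (sym (2*targetWeight (toTarget z)))))
  where
  open ℤ-Solver.+-*-Solver using (solve; Polynomial; con; _:+_; _:*_; _:-_; :-_; _:=_)
  module _ {n : ℕ} where
    quadP : ℤ → ℤ → Polynomial n → Polynomial n
    quadP c δ k = con c :* (k :* k) :+ con δ :* k
    joinP : ℕ → ℕ → Polynomial n → Polynomial n
    joinP d r x = con (+ r) :+ x :* con (+ d)
    source : ℕ → Polynomial n → Polynomial n → Polynomial n
    source r x y = quadP (+ 4) -[1+ 1 ] y :+ quadP (+ 4) -[1+ 1 ] (joinP 5 r x :- con (+ 2) :* y)
    target₁ : Polynomial n → Polynomial n → Polynomial n
    target₁ m n = quadP (+ 5) -[1+ 2 ] m :+ quadP (+ 5) -[1+ 0 ] n
    target₂ : Polynomial n → Polynomial n → Polynomial n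
    target₂ c d = con (+ 2) :+ (quadP (+ 20) -[1+ 9 ] c :+ quadP (+ 20) -[1+ 9 ] d)
  go : ∀ r → doubleSource (fromCoset (r , x , y)) ≡ doubleTarget (toTarget (r , x , y))
  go 0F = solve 2 (λ x y → source 0 x y :=
    target₁ (joinP 2 0 x) (joinP 2 0 (con (+ 2) :* x :- y))) refl x y
  go 1F = solve 2 (λ x y → source 1 x y :=
    target₁ (joinP 2 1 (con (+ 2) :* x :- y)) (joinP 2 0 (:- x))) refl x y
  go 2F = solve 2 (λ x y → source 2 x y :=
    target₂ (:- x) (con (+ 1) :+ con (+ 2) :* x :- y)) refl x y
  go 3F = solve 2 (λ x y → source 3 x y :=
    target₁ (joinP 2 0 (y :- con (+ 2) :* x :- con (+ 1))) (joinP 2 1 x)) refl x y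
  go 4F = solve 2 (λ x y → source 4 x y :=
    target₁ (joinP 2 1 (:- x :- con (+ 1))) (joinP 2 1 (y :- con (+ 2) :* x :- con (+ 2)))) refl x y

module Lattice (N : ℕ) where
  open Trunc N
  open Lists N
  open ≈-Reasoning

  private
    W : List ℤ
    W = window N
    W×W! : Unique (cartesianProduct W W)
    W×W! = Unique.cartesianProduct⁺ (window-unique N) (window-unique N)

    targets : List Target
    targets = map inj₁ (cartesianProduct W W) ++ map inj₂ (cartesianProduct W W)

    targets! : Unique targets
    targets! = Unique.++⁺ (Unique.map⁺ inj₁-injective W×W!) (Unique.map⁺ inj₂-injective W×W!) disjoint
      where
      disjoint : ∀ {y} → y ∈ map inj₁ (cartesianProduct W W) × y ∈ map inj₂ (cartesianProduct W W) → ⊥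
      disjoint (p , q) with ∈-map⁻ inj₁ p | ∈-map⁻ inj₂ q
      ... | _ , _ , refl | _ , _ , ()

    small : ∀ a b → 0 < a → 0 < b → ∀ k → expoℤ a b k ≤ N → k ∈ W
    small a b 0<a 0<b k le = ∈-window N k (≤-trans (∣k∣≤expoℤ a b 0<a 0<b k) le)

    sources-all : ∀ x → sourceWeight x ≤ N → x ∈ cartesianProduct W W
    sources-all (a , b) le = ∈-cartesianProduct⁺
      (small 1 3 z<s z<s a (m+n≤o⇒m≤o _ le)) (small 1 3 z<s z<s b (m+n≤o⇒n≤o (expoℤ 1 3 a) le))

    targets-all : ∀ y → targetWeight y ≤ N → y ∈ targets
    targets-all (inj₁ (m , n)) le = ∈-++⁺ˡ (∈-map⁺ inj₁ (∈-cartesianProduct⁺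
      (small 1 4 z<s z<s m (m+n≤o⇒m≤o _ le)) (small 2 3 z<s z<s n (m+n≤o⇒n≤o (expoℤ 1 4 m) le))))
    targets-all (inj₂ (c , d)) le = ∈-++⁺ʳ (map inj₁ (cartesianProduct W W)) (∈-map⁺ inj₂ (∈-cartesianProduct⁺
      (small 5 15 z<s z<s c (m+n≤o⇒m≤o _ le′)) (small 5 15 z<s z<s d (m+n≤o⇒n≤o (expoℤ 5 15 c) le′))))
      where
      le′ : expoℤ 5 15 c + expoℤ 5 15 d ≤ N
      le′ = ≤-trans (n≤1+n _) le

    lsum-weights : ∀ a b a′ b′ → lsum (λ (k , l) → mono (expoℤ a b k + expoℤ a′ b′ l)) (cartesianProduct W W)
                   ≈ Θ a b N ⊠ Θ a′ b′ N
    lsum-weights a b a′ b′ = ≈-trans (lsum-cong (λ (k , l) → mono-+ (expoℤ a b k) (expoℤ a′ b′ l)) (cartesianProduct W W))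
      (lsum-product (mono ∘ expoℤ a b) (mono ∘ expoℤ a′ b′) W W)

  theta-identity : Θ 1 3 N ⊠ Θ 1 3 N ≈ Θ 1 4 N ⊠ Θ 2 3 N ⊞ mono 1 ⊠ (Θ 5 15 N ⊠ Θ 5 15 N)
  theta-identity = begin
    Θ 1 3 N ⊠ Θ 1 3 N
      ≈⟨ lsum-weights 1 3 1 3 ⟨
    lsum (mono ∘ sourceWeight) (cartesianProduct W W)
      ≈⟨ lsum-reindex sourceWeight targetWeight (toTarget ∘ toCoset) (fromCoset ∘ fromTarget)
           (λ x → trans (cong fromCoset (fromTarget-toTarget (toCoset x))) (fromCoset-toCoset x))
           (λ y → trans (cong toTarget (toCoset-fromCoset (fromTarget y))) (toTarget-fromTarget y))
           (λ x → trans (sym (weights (toCoset x))) (cong sourceWeight (fromCoset-toCoset x)))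
           W×W! targets! sources-all targets-all ⟩
    lsum (mono ∘ targetWeight) targets
      ≈⟨ lsum-++ (mono ∘ targetWeight) (map inj₁ (cartesianProduct W W)) _ ⟩
    lsum (mono ∘ targetWeight) (map inj₁ (cartesianProduct W W)) ⊞ lsum (mono ∘ targetWeight) (map inj₂ (cartesianProduct W W))
      ≈⟨ ⊞-cong (≡⇒≈ (lsum-map (mono ∘ targetWeight) inj₁ (cartesianProduct W W)))
                (≡⇒≈ (lsum-map (mono ∘ targetWeight) inj₂ (cartesianProduct W W))) ⟩
    lsum (mono ∘ targetWeight ∘ inj₁) (cartesianProduct W W) ⊞ lsum (mono ∘ targetWeight ∘ inj₂) (cartesianProduct W W)
      ≈⟨ ⊞-cong (lsum-weights 1 4 2 3)
           (≈-trans (lsum-cong (λ (k , l) → mono-+ 1 (expoℤ 5 15 k + expoℤ 5 15 l)) (cartesianProduct W W))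
             (≈-trans (lsum-⊠ˡ (mono 1) _ (cartesianProduct W W)) (⊠-congˡ (mono 1) (lsum-weights 5 15 5 15)))) ⟩
    Θ 1 4 N ⊠ Θ 2 3 N ⊞ mono 1 ⊠ (Θ 5 15 N ⊠ Θ 5 15 N) ∎

-- Reduction of the eta quotient modulo 2

infixr 8 _^ˢ_
_^ˢ_ : Series₂ → ℕ → Series₂
f ^ˢ zero  = 1ˢ
f ^ˢ suc e = f ⊠ f ^ˢ e

bit : Bool → ℤ
bit true  = + 1
bit false = + 0

infix 4 _≡₂_ _≡₂ˢ_

record _≡₂_ (z : ℤ) (b : Bool) : Set where
  constructor mod2
  field
    half     : ℤ
    residual : z ≡ bit b ℤ.+ + 2 ℤ.* half

_≡₂ˢ_ : Series → Series₂ → Set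
f ≡₂ˢ g = ∀ n → f n ≡₂ g n

≡₂-bit : ∀ b → bit b ≡₂ b
≡₂-bit b = mod2 (+ 0) (sym (ℤ.+-identityʳ (bit b)))

≡₂-+ : ∀ {x y b c} → x ≡₂ b → y ≡₂ c → x ℤ.+ y ≡₂ b xor c
≡₂-+ {b = b} {c} (mod2 w refl) (mod2 v refl) = mod2 (w ℤ.+ v ℤ.+ carry b c) (trans (lemma₁ (bit b) (bit c) w v)
  (trans (cong (ℤ._+ + 2 ℤ.* (w ℤ.+ v)) (sum b c)) (lemma₂ (bit (b xor c)) (carry b c) w v)))
  where
  carry : Bool → Bool → ℤ
  carry b c = bit (b ∧ c)
  sum : ∀ b c → bit b ℤ.+ bit c ≡ bit (b xor c) ℤ.+ + 2 ℤ.* carry b c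
  sum false false = refl
  sum false true  = refl
  sum true  false = refl
  sum true  true  = refl
  lemma₁ : ∀ x y w v → (x ℤ.+ + 2 ℤ.* w) ℤ.+ (y ℤ.+ + 2 ℤ.* v) ≡ x ℤ.+ y ℤ.+ + 2 ℤ.* (w ℤ.+ v)
  lemma₁ = ℤ.solve-∀
  lemma₂ : ∀ x y w v → x ℤ.+ + 2 ℤ.* y ℤ.+ + 2 ℤ.* (w ℤ.+ v) ≡ x ℤ.+ + 2 ℤ.* (w ℤ.+ v ℤ.+ y)
  lemma₂ = ℤ.solve-∀

≡₂-* : ∀ {x y b c} → x ≡₂ b → y ≡₂ c → x ℤ.* y ≡₂ b ∧ c
≡₂-* {b = b} {c} (mod2 w refl) (mod2 v refl) = mod2 z
  (trans (lemma (bit b) (bit c) w v) (cong (ℤ._+ + 2 ℤ.* z) (product b c)))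
  where
  z : ℤ
  z = bit b ℤ.* v ℤ.+ w ℤ.* bit c ℤ.+ + 2 ℤ.* w ℤ.* v
  product : ∀ b c → bit b ℤ.* bit c ≡ bit (b ∧ c)
  product false false = refl
  product false true  = refl
  product true  false = refl
  product true  true  = refl
  lemma : ∀ x y w v → (x ℤ.+ + 2 ℤ.* w) ℤ.* (y ℤ.+ + 2 ℤ.* v)
                    ≡ x ℤ.* y ℤ.+ + 2 ℤ.* (x ℤ.* v ℤ.+ w ℤ.* y ℤ.+ + 2 ℤ.* w ℤ.* v)
  lemma = ℤ.solve-∀

≡₂-unique⇒2∣ : ∀ {x y b} → x ≡₂ b → y ≡₂ b → (+ 2) ℤD.∣ (x ℤ.- y)
≡₂-unique⇒2∣ {b = b} (mod2 w refl) (mod2 v refl) = subst (λ z → 2 ∣ ∣ z ∣) (sym (lemma (bit b) w v))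
  (subst (2 ∣_) (sym (ℤ.abs-* (+ 2) (w ℤ.- v))) (m∣m*n ∣ w ℤ.- v ∣))
  where
  lemma : ∀ x w v → (x ℤ.+ + 2 ℤ.* w) ℤ.- (x ℤ.+ + 2 ℤ.* v) ≡ + 2 ℤ.* (w ℤ.- v)
  lemma = ℤ.solve-∀

sumℤ : List ℤ → ℤ
sumℤ = foldr ℤ._+_ (+ 0)

-- Once the mapped list is an `applyUpTo`, peeling its head shifts `f` and fixes `g`, exactly as the
-- recursion of `_⊠_` does; `go` is therefore general in `f`.
⊛-≡₂ : ∀ {f f′ g g′} → f ≡₂ˢ f′ → g ≡₂ˢ g′ → (f ⊛ g) ≡₂ˢ (f′ ⊠ g′)
⊛-≡₂ {f} {f′} {g} {g′} p q n = subst (λ l → sumℤ l ≡₂ (f′ ⊠ g′) n) (sym (map-upTo (λ i → f i ℤ.* g (n ∸ i)) (suc n))) (go n p)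
  where
  go : ∀ n {f f′} → f ≡₂ˢ f′ → sumℤ (applyUpTo (λ i → f i ℤ.* g (n ∸ i)) (suc n)) ≡₂ (f′ ⊠ g′) n
  go zero    {f} p = subst (_≡₂ _) (sym (ℤ.+-identityʳ (f 0 ℤ.* g 0))) (≡₂-* (p 0) (q 0))
  go (suc n) p = ≡₂-+ (≡₂-* (p 0) (q (suc n))) (go n (p ∘ suc))

oneS-≡₂ : oneS ≡₂ˢ 1ˢ
oneS-≡₂ zero    = ≡₂-bit true
oneS-≡₂ (suc n) = ≡₂-bit false

^S-≡₂ : ∀ {f f′} e → f ≡₂ˢ f′ → (f ^S e) ≡₂ˢ (f′ ^ˢ e)
^S-≡₂ zero    p = oneS-≡₂
^S-≡₂ (suc e) p = ⊛-≡₂ p (^S-≡₂ e p)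

mono-self : ∀ e → mono e e ≡ true
mono-self zero    = refl
mono-self (suc e) = mono-self e

mono-true : ∀ e n → mono e n ≡ true → e ≡ n
mono-true zero    zero    _ = refl
mono-true (suc e) (suc n) p = cong suc (mono-true e n p)

mono-other : ∀ e n → e ≢ n → mono e n ≡ false
mono-other e n e≢n with mono e n in eq
... | true  = contradiction (mono-true e n eq) e≢n
... | false = refl

oneMinusQ-≡₂ : ∀ k → oneMinusQ (suc k) ≡₂ˢ (1ˢ ⊞ mono (suc k))
oneMinusQ-≡₂ k zero    = subst (+ 1 ≡₂_) (sym (⊞-coeff 1ˢ (mono (suc k)) 0)) (≡₂-bit true)
oneMinusQ-≡₂ k (suc m) = subst (oneMinusQ (suc k) (suc m) ≡₂_) (sym (⊞-coeff 1ˢ (mono (suc k)) (suc m))) (go m)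
  where
  go : ∀ m → (if ⌊ suc k ≟ suc m ⌋ then ℤ.- (+ 1) else + 0) ≡₂ mono (suc k) (suc m)
  go m with suc k ≟ suc m
  -- -1 = 1 + 2·(-1), so the half is again -1.
  ... | yes refl = subst (-[1+ 0 ] ≡₂_) (sym (mono-self k)) (mod2 -[1+ 0 ] refl)
  ... | no k≢m   = subst (+ 0 ≡₂_) (sym (mono-other (suc k) (suc m) k≢m)) (≡₂-bit false)

geomS-≡₂ : ∀ k → geomS k ≡₂ˢ geom₂ k
geomS-≡₂ k m rewrite isYes≗does (k ∣? m) = go (does (k ∣? m))
  where
  go : ∀ b → (if b then + 1 else + 0) ≡₂ b
  go true  = ≡₂-bit true
  go false = ≡₂-bit false

factor₂ : ℕ → Series₂
factor₂ n = (1ˢ ⊞ mono (2 * n)) ⊠ (1ˢ ⊞ mono (5 * n)) ^ˢ 5 ⊠ geom₂ n ⊠ geom₂ (10 * n) ^ˢ 5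

factor-≡₂ : ∀ n → factor (suc n) ≡₂ˢ factor₂ (suc n)
factor-≡₂ n = ⊛-≡₂ (⊛-≡₂ (⊛-≡₂ (oneMinusQ-≡₂ _) (^S-≡₂ 5 (oneMinusQ-≡₂ _))) (geomS-≡₂ (suc n))) (^S-≡₂ 5 (geomS-≡₂ (10 * suc n)))

etaQuotient₂ : ℕ → Series₂
etaQuotient₂ N = prod N (factor₂ ∘ suc)

prodUpTo-≡₂ : ∀ N → prodUpTo N ≡₂ˢ etaQuotient₂ N
prodUpTo-≡₂ zero    = oneS-≡₂
prodUpTo-≡₂ (suc N) = ⊛-≡₂ (prodUpTo-≡₂ N) (factor-≡₂ N)

-- Dissection of the eta quotient f₁/f₅⁵ modulo 2.

module Level10 (N : ℕ) where
  open Trunc N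
  open JacobiTriple N
  open Lists N
  open Lattice N
  open Solver using (solve; _:+_; _:*_; _:=_; con; _:^_)
  open ≈-Reasoning

  prod-+ : ∀ m n f → prod (m + n) f ≈ prod m f ⊠ prod n (λ i → f (m + i))
  prod-+ m zero    f = ≈-trans (≡⇒≈ (cong (λ k → prod k f) (+-identityʳ m))) (≈-sym (⊠-identityʳ′ _))
  prod-+ m (suc n) f = ≈-trans (≡⇒≈ (cong (λ k → prod k f) (+-suc m n)))
    (≈-trans (⊠-congʳ _ (prod-+ m n f)) (solve 3 (λ a b c → a :* b :* c := a :* (b :* c)) ≈-refl _ _ _))

  prod-blocks : ∀ n d f → prod (n * d) f ≈ prod n (λ i → prod d (λ r → f (i * d + r)))
  prod-blocks zero    d f = ≈-refl
  prod-blocks (suc n) d f = ≈-trans (≡⇒≈ (cong (λ k → prod k f) (+-comm d (n * d))))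
    (≈-trans (prod-+ (n * d) d f) (⊠-congʳ _ (prod-blocks n d f)))

  prod-swap : ∀ n d (g : ℕ → ℕ → Series₂) → prod n (λ i → prod d (g i)) ≈ prod d (λ r → prod n (λ i → g i r))
  prod-swap n zero    g = prod-1 n
  prod-swap n (suc d) g = ≈-trans (prod-⊠ n (λ i → prod d (g i)) (λ i → g i d)) (⊠-congʳ _ (prod-swap n d g))

  -- Sorts the multiples of `s` by their quotient modulo `d`. The blocks reach up to `N * d`
  -- factors; the surplus over `N` lies beyond degree `N`, and the trivial factor `mono 0` only fits
  -- the shape of `prod-stable-≤`.
  residue-classes : ∀ s d → 0 < s → 0 < d → prod d (λ r → prod N (fac (s + s * r) (s * d))) ≈ euler s N
  residue-classes s d 0<s 0<d = begin
    prod d (λ r → prod N (fac (s + s * r) (s * d)))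
      ≈⟨ prod-swap N d (λ i r → fac (s + s * r) (s * d) i) ⟨
    prod N (λ i → prod d (λ r → fac (s + s * r) (s * d) i))
      ≈⟨ prod-cong N (λ i _ → prod-cong d λ r _ → ≡⇒≈ (cong (λ e → 1ˢ ⊞ mono e) (lemma s d r i))) ⟩
    prod N (λ i → prod d (λ r → fac s s (i * d + r)))
      ≈⟨ prod-blocks N d (fac s s) ⟨
    prod (N * d) (fac s s)
      ≈⟨ pointwise (⊠-identityˡ _) ⟨
    mono 0 ⊠ prod (N * d) (fac s s)
      ≈⟨ prod-stable-≤ 0 s s (m≤m*n N d {{>-nonZero 0<d}}) (+-mono-≤ 0<s (m≤n*m N s {{>-nonZero 0<s}})) ⟩
    mono 0 ⊠ euler s N
      ≈⟨ pointwise (⊠-identityˡ _) ⟩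
    euler s N ∎
    where
    lemma : ∀ s d r i → s + s * r + s * d * i ≡ s + s * (i * d + r)
    lemma = solve-∀

  euler-double : ∀ s → euler (s * 2) N ≈ euler s N ⊠ euler s N
  euler-double s = begin
    euler (s * 2) N                         ≈⟨ prod-cong N (λ i _ → square i) ⟩
    prod N (λ i → fac s s i ⊠ fac s s i)      ≈⟨ prod-⊠ N (fac s s) (fac s s) ⟩
    euler s N ⊠ euler s N                     ∎
    where
    lemma : ∀ s i → s * 2 + s * 2 * i ≡ (s + s * i) + (s + s * i)
    lemma = solve-∀
    square : ∀ i → fac (s * 2) (s * 2) i ≈ fac s s i ⊠ fac s s i
    square i = begin
      1ˢ ⊞ mono (s * 2 + s * 2 * i)   ≈⟨ ⊞-cong ≈-refl (≈-trans (≡⇒≈ (cong mono (lemma s i))) (mono-+ (s + s * i) _)) ⟩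
      1ˢ ⊞ mono (s + s * i) ⊠ mono (s + s * i)
        ≈⟨ solve 1 (λ m → con true :+ m :* m := (con true :+ m) :* (con true :+ m)) ≈-refl _ ⟩
      fac s s i ⊠ fac s s i ∎

  -- With x = `euler s N`, the factor `euler (s * 4) N` is x⁴. One x² of it equals
  -- `euler (s * 2) N`, which supplies the two even classes modulo 4 missing from the product; the
  -- four classes together give x, and x · x² remains. This avoids dividing by f₂.
  theta-triangular : ∀ s → 0 < s →
    prod N (fac (s + s * 2) (s * 4)) ⊠ prod N (fac (s + s * 0) (s * 4)) ⊠ euler (s * 4) N ≈ euler s N ^ˢ 3
  theta-triangular s 0<s = begin
    P 2 ⊠ P 0 ⊠ euler (s * 4) N
      ≈⟨ ⊠-congˡ (P 2 ⊠ P 0) quadruple ⟩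
    P 2 ⊠ P 0 ⊠ ((x ⊠ x) ⊠ (x ⊠ x))
      ≈⟨ solve 3 (λ a b x → a :* b :* ((x :* x) :* (x :* x)) := a :* b :* (x :* x) :* (x :* x)) ≈-refl (P 2) (P 0) x ⟩
    P 2 ⊠ P 0 ⊠ (x ⊠ x) ⊠ (x ⊠ x)
      ≈⟨ ⊠-congʳ _ (⊠-congˡ (P 2 ⊠ P 0) even) ⟨
    P 2 ⊠ P 0 ⊠ (P 1 ⊠ P 3) ⊠ (x ⊠ x)
      ≈⟨ solve 5 (λ a b c d x → c :* a :* (b :* d) :* (x :* x) := (con true :* a :* b :* c :* d) :* (x :* x))
           ≈-refl (P 0) (P 1) (P 2) (P 3) x ⟩
    prod 4 P ⊠ (x ⊠ x)
      ≈⟨ ⊠-congʳ _ (residue-classes s 4 0<s z<s) ⟩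
    x ⊠ (x ⊠ x)
      ≈⟨ solve 1 (λ x → x :* (x :* x) := x :* (x :* (x :* con true))) ≈-refl x ⟩
    x ^ˢ 3 ∎
    where
    x = euler s N
    P : ℕ → Series₂
    P r = prod N (fac (s + s * r) (s * 4))
    quadruple : euler (s * 4) N ≈ (x ⊠ x) ⊠ (x ⊠ x)
    quadruple = ≈-trans (≡⇒≈ (cong (λ k → euler k N) (sym (*-assoc s 2 2))))
      (≈-trans (euler-double (s * 2)) (⊠-cong (euler-double s) (euler-double s)))
    even : P 1 ⊠ P 3 ≈ x ⊠ x
    even = begin
      P 1 ⊠ P 3
        ≈⟨ ⊠-cong (≡⇒≈ (cong₂ (λ a c → prod N (fac a c)) (lemma₁ s) (lemma₀ s)))
                  (≡⇒≈ (cong₂ (λ a c → prod N (fac a c)) (lemma₃ s) (lemma₀ s))) ⟩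
      Q 0 ⊠ Q 1
        ≈⟨ ⊠-congʳ _ (pointwise (⊠-identityˡ _)) ⟨
      prod 2 Q
        ≈⟨ residue-classes (s * 2) 2 (*-mono-≤ 0<s (s≤s z≤n)) z<s ⟩
      euler (s * 2) N
        ≈⟨ euler-double s ⟩
      x ⊠ x ∎
      where
      Q : ℕ → Series₂
      Q r = prod N (fac (s * 2 + s * 2 * r) (s * 2 * 2))
      lemma₀ : ∀ s → s * 4 ≡ s * 2 * 2
      lemma₀ = solve-∀
      lemma₁ : ∀ s → s + s * 1 ≡ s * 2 + s * 2 * 0
      lemma₁ = solve-∀
      lemma₃ : ∀ s → s + s * 3 ≡ s * 2 + s * 2 * 1
      lemma₃ = solve-∀

  private
    q x y g h : Series₂
    q = mono 1
    x = euler 1 N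
    y = euler 5 N
    g = euler⁻¹ 1 N
    h = euler⁻¹ 5 N

    xg≈1 : x ⊠ g ≈ 1ˢ
    xg≈1 = prod-inverse 1 1 N z<s

    yh≈1 : y ⊠ h ≈ 1ˢ
    yh≈1 = prod-inverse 5 5 N z<s

    Θ₁₃ : Θ 1 3 N ≈ x ^ˢ 3
    Θ₁₃ = ≈-trans (≈-sym (theta-product 1 3 z<s z<s)) (theta-triangular 1 z<s)

    Θ₅₁₅ : Θ 5 15 N ≈ y ^ˢ 3
    Θ₅₁₅ = ≈-trans (≈-sym (theta-product 5 15 z<s z<s)) (theta-triangular 5 z<s)

    -- The two theta products supply the exponent classes 1, 4 and 2, 3 modulo 5, and each also
    -- brings f₅: one copy completes f₁, the other remains.
    Θ₁₄Θ₂₃ : Θ 1 4 N ⊠ Θ 2 3 N ≈ x ⊠ y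
    Θ₁₄Θ₂₃ = begin
      Θ 1 4 N ⊠ Θ 2 3 N
        ≈⟨ ⊠-cong (theta-product 1 4 z<s z<s) (theta-product 2 3 z<s z<s) ⟨
      (P 3 ⊠ P 0 ⊠ P 4) ⊠ (P 2 ⊠ P 1 ⊠ P 4)
        ≈⟨ solve 5 (λ a b c d e → (d :* a :* e) :* (c :* b :* e) := con true :* a :* b :* c :* d :* e :* e)
             ≈-refl (P 0) (P 1) (P 2) (P 3) (P 4) ⟩
      prod 5 P ⊠ P 4
        ≈⟨ ⊠-congʳ _ (residue-classes 1 5 z<s z<s) ⟩
      x ⊠ y ∎
      where
      P : ℕ → Series₂
      P r = prod N (fac (1 + 1 * r) (1 * 5))

    xy≈Θ : x ⊠ y ≈ Θ 1 3 N ⊠ Θ 1 3 N ⊞ q ⊠ (Θ 5 15 N ⊠ Θ 5 15 N)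
    xy≈Θ = begin
      x ⊠ y
        ≈⟨ Θ₁₄Θ₂₃ ⟨
      Θ 1 4 N ⊠ Θ 2 3 N
        -- In characteristic 2, adding a term twice moves it to the other side.
        ≈⟨ solve 2 (λ a b → a := (a :+ b) :+ b) ≈-refl _ (q ⊠ (Θ 5 15 N ⊠ Θ 5 15 N)) ⟩
      (Θ 1 4 N ⊠ Θ 2 3 N ⊞ q ⊠ (Θ 5 15 N ⊠ Θ 5 15 N)) ⊞ q ⊠ (Θ 5 15 N ⊠ Θ 5 15 N)
        ≈⟨ ⊞-cong theta-identity ≈-refl ⟨
      Θ 1 3 N ⊠ Θ 1 3 N ⊞ q ⊠ (Θ 5 15 N ⊠ Θ 5 15 N) ∎

    xy≈ : x ⊠ y ≈ x ^ˢ 3 ⊠ x ^ˢ 3 ⊞ q ⊠ (y ^ˢ 3 ⊠ y ^ˢ 3)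
    xy≈ = ≈-trans xy≈Θ (⊞-cong (⊠-cong Θ₁₃ Θ₁₃) (⊠-congˡ q (⊠-cong Θ₅₁₅ Θ₅₁₅)))

    ^ˢ-cong : ∀ {f f′} e → f ≈ f′ → f ^ˢ e ≈ f′ ^ˢ e
    ^ˢ-cong zero    p = ≈-refl
    ^ˢ-cong (suc e) p = ⊠-cong p (^ˢ-cong e p)

    prod-^ˢ : ∀ n f e → prod n (λ i → f i ^ˢ e) ≈ prod n f ^ˢ e
    prod-^ˢ n f zero    = prod-1 n
    prod-^ˢ n f (suc e) = ≈-trans (prod-⊠ n f _) (⊠-congˡ _ (prod-^ˢ n f e))

    1^ˢ : ∀ {u} e → u ≈ 1ˢ → u ^ˢ e ≈ 1ˢ
    1^ˢ zero    p = ≈-refl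
    1^ˢ (suc e) p = ≈-trans (⊠-cong p (1^ˢ e p)) (⊠-identityʳ′ 1ˢ)

    prod-reindex : ∀ (F : ℕ → Series₂) k → prod N (λ i → F (k * suc i)) ≈ prod N (λ i → F (k + k * i))
    prod-reindex F k = prod-cong N λ i _ → ≡⇒≈ (cong F (*-suc k i))

    h₁₀ : euler⁻¹ 10 N ≈ h ⊠ h
    h₁₀ = begin
      k                           ≈⟨ pad k (≈-trans (⊠-cong yh≈1 yh≈1) (⊠-identityʳ′ 1ˢ)) ⟩
      k ⊠ ((y ⊠ h) ⊠ (y ⊠ h))     ≈⟨ solve 3 (λ k y h → k :* ((y :* h) :* (y :* h)) := (h :* h) :* ((y :* y) :* k)) ≈-refl k y h ⟩
      (h ⊠ h) ⊠ ((y ⊠ y) ⊠ k)     ≈⟨ ⊠-congˡ _ (⊠-congʳ k (euler-double 5)) ⟨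
      (h ⊠ h) ⊠ (euler 10 N ⊠ k)  ≈⟨ pad _ (prod-inverse 10 10 N z<s) ⟨
      h ⊠ h                       ∎
      where k = euler⁻¹ 10 N

    pow : ∀ {n} → ℕ → Solver.Polynomial n → Solver.Polynomial n
    pow zero    p = con true
    pow (suc e) p = p :* pow e p

    -- f₂ f₅⁵ / (f₁ f₁₀⁵) with f₂ ≡ f₁² and f₁₀ ≡ f₅². Here `g` and `h` stand for 1/f₁ and 1/f₅.
    etaQuotient≈ : etaQuotient₂ N ≈ x ⊠ h ^ˢ 5
    etaQuotient≈ = begin
      etaQuotient₂ N
        ≈⟨ prod-⊠ N (λ i → u i ⊠ v i ^ˢ 5 ⊠ geom₂ (suc i)) (λ i → geom₂ (10 * suc i) ^ˢ 5) ⟩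
      prod N (λ i → u i ⊠ v i ^ˢ 5 ⊠ geom₂ (suc i)) ⊠ prod N (λ i → geom₂ (10 * suc i) ^ˢ 5)
        ≈⟨ ⊠-cong (≈-trans (prod-⊠ N (λ i → u i ⊠ v i ^ˢ 5) (geom₂ ∘ suc)) (⊠-congʳ _ (prod-⊠ N u (λ i → v i ^ˢ 5))))
                  (prod-^ˢ N (λ i → geom₂ (10 * suc i)) 5) ⟩
      prod N u ⊠ prod N (λ i → v i ^ˢ 5) ⊠ prod N (geom₂ ∘ suc) ⊠ prod N (λ i → geom₂ (10 * suc i)) ^ˢ 5
        ≈⟨ ⊠-cong (⊠-cong (⊠-cong
             (≈-trans (prod-reindex (λ e → 1ˢ ⊞ mono e) 2) (euler-double 1))
             (≈-trans (prod-^ˢ N v 5) (^ˢ-cong 5 (prod-reindex (λ e → 1ˢ ⊞ mono e) 5))))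
             (prod-cong N λ i _ → ≡⇒≈ (cong (geom₂ ∘ suc) (sym (*-identityˡ i)))))
             (^ˢ-cong 5 (≈-trans (prod-reindex geom₂ 10) h₁₀)) ⟩
      (x ⊠ x) ⊠ y ^ˢ 5 ⊠ g ⊠ (h ⊠ h) ^ˢ 5
        ≈⟨ solve 4 (λ x y g h → (x :* x) :* pow 5 y :* g :* pow 5 (h :* h)
             := x :* pow 5 h :* (x :* g) :* pow 5 (y :* h)) ≈-refl x y g h ⟩
      x ⊠ h ^ˢ 5 ⊠ (x ⊠ g) ⊠ (y ⊠ h) ^ˢ 5
        ≈⟨ pad _ (1^ˢ 5 yh≈1) ⟨
      x ⊠ h ^ˢ 5 ⊠ (x ⊠ g)
        ≈⟨ pad _ xg≈1 ⟨
      x ⊠ h ^ˢ 5 ∎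
      where
      u v : ℕ → Series₂
      u i = 1ˢ ⊞ mono (2 * suc i)
      v i = 1ˢ ⊞ mono (5 * suc i)

    X Y : Series₂
    X = (x ⊠ h) ^ˢ 3
    Y = x ^ˢ 4 ⊠ h ^ˢ 2

    etaQuotient-dissection : etaQuotient₂ N ≈ X ⊠ X ⊞ q
    etaQuotient-dissection = begin
      etaQuotient₂ N
        ≈⟨ etaQuotient≈ ⟩
      x ⊠ h ^ˢ 5
        ≈⟨ pad _ yh≈1 ⟩
      x ⊠ h ^ˢ 5 ⊠ (y ⊠ h)
        ≈⟨ solve 3 (λ x y h → x :* pow 5 h :* (y :* h) := (x :* y) :* pow 6 h) ≈-refl x y h ⟩
      (x ⊠ y) ⊠ h ^ˢ 6
        ≈⟨ ⊠-congʳ _ xy≈ ⟩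
      (x ^ˢ 3 ⊠ x ^ˢ 3 ⊞ q ⊠ (y ^ˢ 3 ⊠ y ^ˢ 3)) ⊠ h ^ˢ 6
        ≈⟨ solve 4 (λ x y h q → (pow 3 x :* pow 3 x :+ q :* (pow 3 y :* pow 3 y)) :* pow 6 h
             := pow 3 (x :* h) :* pow 3 (x :* h) :+ q :* pow 6 (y :* h)) ≈-refl x y h q ⟩
      X ⊠ X ⊞ q ⊠ (y ⊠ h) ^ˢ 6
        ≈⟨ ⊞-cong ≈-refl (pad q (1^ˢ 6 yh≈1)) ⟨
      X ⊠ X ⊞ q ∎

    -- X = (f₁ f₅)(f₁/f₅²)², and the square cofactor preserves the form u² + q v².
    X-dissection : X ≈ Y ⊠ Y ⊞ q ⊠ ((x ⊠ y) ⊠ (x ⊠ y))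
    X-dissection = begin
      X
        ≈⟨ pad X yh≈1 ⟩
      X ⊠ (y ⊠ h)
        ≈⟨ solve 3 (λ x y h → pow 3 (x :* h) :* (y :* h) := (x :* y) :* (pow 2 x :* pow 4 h)) ≈-refl x y h ⟩
      (x ⊠ y) ⊠ (x ^ˢ 2 ⊠ h ^ˢ 4)
        ≈⟨ ⊠-congʳ _ xy≈ ⟩
      (x ^ˢ 3 ⊠ x ^ˢ 3 ⊞ q ⊠ (y ^ˢ 3 ⊠ y ^ˢ 3)) ⊠ (x ^ˢ 2 ⊠ h ^ˢ 4)
        ≈⟨ solve 4 (λ x y h q → (pow 3 x :* pow 3 x :+ q :* (pow 3 y :* pow 3 y)) :* (pow 2 x :* pow 4 h)
             := (pow 4 x :* pow 2 h) :* (pow 4 x :* pow 2 h) :+ q :* ((x :* y) :* (x :* y)) :* pow 4 (y :* h)) ≈-refl x y h q ⟩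
      Y ⊠ Y ⊞ q ⊠ ((x ⊠ y) ⊠ (x ⊠ y)) ⊠ (y ⊠ h) ^ˢ 4
        ≈⟨ ⊞-cong ≈-refl (pad _ (1^ˢ 4 yh≈1)) ⟨
      Y ⊠ Y ⊞ q ⊠ ((x ⊠ y) ⊠ (x ⊠ y)) ∎

    -- By Frobenius u² lives in even degrees and q v² in odd ones.
    square+q : ∀ {f} u v → f ≈ u ⊠ u ⊞ q ⊠ (v ⊠ v) →
               (∀ n → n + n ≤ N → f (n + n) ≡ u n) × (∀ n → suc (n + n) ≤ N → f (suc (n + n)) ≡ v n)
    square+q {f} u v p = even , odd
      where
      coefficient : ∀ i → i ≤ N → f i ≡ (u ⊠ u) i xor (q ⊠ (v ⊠ v)) i
      coefficient i i≤N = trans (at p i i≤N) (⊞-coeff (u ⊠ u) (q ⊠ (v ⊠ v)) i)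
      q-even : ∀ n → (q ⊠ (v ⊠ v)) (n + n) ≡ false
      q-even zero    = refl
      q-even (suc n) = trans (mono-⊠-shift 1 (v ⊠ v) (n + suc n)) (trans (cong (v ⊠ v) (+-suc n n)) (square-odd v n))
      even : ∀ n → n + n ≤ N → f (n + n) ≡ u n
      even n le = trans (coefficient _ le) (trans (cong₂ _xor_ (square-even u n) (q-even n)) (xor-identityʳ (u n)))
      odd : ∀ n → suc (n + n) ≤ N → f (suc (n + n)) ≡ v n
      odd n le = trans (coefficient _ le) (cong₂ _xor_ (square-odd u n) (trans (mono-⊠-shift 1 (v ⊠ v) (n + n)) (square-even v n)))

    -- Degree 4j + 2 is twice 2j + 1: the even part of the quotient gives coefficient 2j + 1 of `X`,
    -- whose odd part gives coefficient j of f₁ f₅.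
    etaQuotient-xy : ∀ j → suc (j + j) + suc (j + j) ≤ N →
                     etaQuotient₂ N (suc (j + j) + suc (j + j)) ≡ (x ⊠ y) j
    etaQuotient-xy j le = trans
      (proj₁ (square+q X 1ˢ (≈-trans etaQuotient-dissection
        (⊞-cong ≈-refl (≈-trans (pad q ≈-refl) (⊠-congˡ q (pad 1ˢ ≈-refl)))))) (suc (j + j)) le)
      (proj₂ (square+q Y (x ⊠ y) X-dissection) j (≤-trans (m≤m+n _ _) le))

  etaQuotient-even : ∀ i → let j = i + i ; n = suc (j + j) in n + n ≤ N →
                     etaQuotient₂ N (n + n) ≡ Θ 1 3 N i
  etaQuotient-even i le = trans (etaQuotient-xy (i + i) le)
    (proj₁ (square+q (Θ 1 3 N) (Θ 5 15 N) xy≈Θ) i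
      (≤-trans (≤-trans (m≤m+n _ _) (n≤1+n _)) (≤-trans (m≤m+n _ _) le)))

  etaQuotient-odd : ∀ i → let j = suc (i + i) ; n = suc (j + j) in n + n ≤ N →
                    etaQuotient₂ N (n + n) ≡ Θ 5 15 N i
  etaQuotient-odd i le = trans (etaQuotient-xy (suc (i + i)) le)
    (proj₂ (square+q (Θ 1 3 N) (Θ 5 15 N) xy≈Θ) i
      (≤-trans (≤-trans (m≤m+n _ _) (n≤1+n _)) (≤-trans (m≤m+n _ _) le)))

-- Squares

lsum-true⇒∃ : ∀ {A : Set} (w : A → ℕ) xs i → lsum (mono ∘ w) xs i ≡ true → ∃ λ x → w x ≡ i
lsum-true⇒∃ w (x ∷ xs) i p with mono (w x) i in eq | ⊞-coeff (mono (w x)) (lsum (mono ∘ w) xs) i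
... | true  | _ = x , mono-true (w x) i eq
... | false | e = lsum-true⇒∃ w xs i (trans (sym e) p)

-- A coefficient over 𝔽₂ is the parity of a number of representations; injectivity of `w` makes that
-- number exactly one.
lsum-∈⇒true : ∀ {A : Set} (w : A → ℕ) → (∀ {x y} → w x ≡ w y → x ≡ y) →
              ∀ {xs x} → Unique xs → x ∈ xs → lsum (mono ∘ w) xs (w x) ≡ true
lsum-∈⇒true w inj {y ∷ ys} {x} (y∉ys ∷ ys!) x∈ = trans (⊞-coeff (mono (w y)) (lsum (mono ∘ w) ys) (w x)) (go x∈)
  where
  absent : ∀ zs → All.All (x ≢_) zs → lsum (mono ∘ w) zs (w x) ≡ false
  absent []       All.[]        = refl
  absent (z ∷ zs) (x≢z All.∷ p) = trans (⊞-coeff (mono (w z)) (lsum (mono ∘ w) zs) (w x))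
    (cong₂ _xor_ (mono-other (w z) (w x) (x≢z ∘ inj ∘ sym)) (absent zs p))
  go : x ∈ y ∷ ys → mono (w y) (w x) xor lsum (mono ∘ w) ys (w x) ≡ true
  go (here refl)  = cong₂ _xor_ (mono-self (w x)) (absent ys y∉ys)
  go (there x∈ys) = cong₂ _xor_ (mono-other (w y) (w x) (λ e → All.lookup y∉ys x∈ys (inj e)))
                                (lsum-∈⇒true w inj ys! x∈ys)

Θ-true⇒ : ∀ a b N i → Θ a b N i ≡ true → ∃ λ k → expoℤ a b k ≡ i
Θ-true⇒ a b N i = lsum-true⇒∃ (expoℤ a b) (window N) i

Θ-true⇐ : ∀ a b → 0 < a → 0 < b → (∀ {k l} → expoℤ a b k ≡ expoℤ a b l → k ≡ l) →
          ∀ N k → expoℤ a b k ≤ N → Θ a b N (expoℤ a b k) ≡ true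
Θ-true⇐ a b 0<a 0<b inj N k le = lsum-∈⇒true (expoℤ a b) inj (window-unique N)
  (∈-window N k (≤-trans (∣k∣≤expoℤ a b 0<a 0<b k) le))

-- The difference of the exponents is (k - l)(2(k + l) - 1), and the second factor is odd, hence
-- nonzero.
expoℤ-injective : ∀ {k l} → expoℤ 1 3 k ≡ expoℤ 1 3 l → k ≡ l
expoℤ-injective {k} {l} e with ℤ.i*j≡0⇒i≡0∨j≡0 (k ℤ.- l) product
  where
  factor-difference : ∀ k l → + 2 ℤ.* ((k ℤ.- l) ℤ.* (+ 2 ℤ.* (k ℤ.+ l) ℤ.- + 1)) ≡ quad (+ 4) -[1+ 1 ] k ℤ.- quad (+ 4) -[1+ 1 ] l
  factor-difference = solve 2 (λ k l → con (+ 2) :* ((k :- l) :* (con (+ 2) :* (k :+ l) :- con (+ 1)))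
    := (con (+ 4) :* (k :* k) :+ con -[1+ 1 ] :* k) :- (con (+ 4) :* (l :* l) :+ con -[1+ 1 ] :* l)) refl
    where
    open ℤ-Solver.+-*-Solver
  product : (k ℤ.- l) ℤ.* (+ 2 ℤ.* (k ℤ.+ l) ℤ.- + 1) ≡ + 0
  product = ℤ.*-cancelˡ-≡ (+ 2) _ (+ 0) (trans (factor-difference k l)
    (ℤ.i≡j⇒i-j≡0 (trans (sym (2*expoℤ 1 3 k)) (trans (cong (λ n → + 2 ℤ.* + n) e) (2*expoℤ 1 3 l)))))
... | inj₁ k-l≡0 = ℤ.i-j≡0⇒i≡j k l k-l≡0
... | inj₂ odd≡0 = contradiction (∣1⇒≡1 2∣1) λ ()
  where
  2∣1 : 2 ∣ 1
  2∣1 = subst (2 ∣_) (trans (sym (ℤ.abs-* (+ 2) (k ℤ.+ l))) (cong ∣_∣ (ℤ.i-j≡0⇒i≡j (+ 2 ℤ.* (k ℤ.+ l)) (+ 1) odd≡0)))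
          (m∣m*n ∣ k ℤ.+ l ∣)

expoℤ-scale : ∀ k → expoℤ 5 15 k ≡ 5 * expoℤ 1 3 k
expoℤ-scale (+ k)    = lemma (choose2 k) k
  where
  lemma : ∀ c k → 20 * c + 5 * k ≡ 5 * (4 * c + 1 * k)
  lemma = solve-∀
expoℤ-scale -[1+ k ] = lemma (choose2 k + k) (suc k)
  where
  lemma : ∀ c k → 20 * c + 15 * k ≡ 5 * (4 * c + 3 * k)
  lemma = solve-∀

-- |4k − 1|
root : ℤ → ℕ
root (+ zero)  = 1
root (+ suc k) = 4 * k + 3
root -[1+ k ]  = 4 * suc k + 1

-- Completing the square: `expoℤ 1 3 k` is 2k² - k.
root-square : ∀ k → root k * root k ≡ 8 * expoℤ 1 3 k + 1
root-square (+ zero)  = refl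
root-square (+ suc k) = +-cancelʳ-≡ (8 * suc k) _ _ (begin
  (4 * k + 3) * (4 * k + 3) + 8 * suc k        ≡⟨ lemma₁ k ⟩
  16 * (suc k * suc k) + 1                              ≡⟨ cong (λ s → 16 * s + 1) (2*choose2 (suc k)) ⟨
  16 * (2 * choose2 (suc k) + suc k) + 1              ≡⟨ lemma₂ (choose2 (suc k)) k ⟩
  8 * expoℤ 1 3 (+ suc k) + 1 + 8 * suc k             ∎)
  where
  open ≡-Reasoning
  lemma₁ : ∀ k → (4 * k + 3) * (4 * k + 3) + 8 * suc k ≡ 16 * (suc k * suc k) + 1
  lemma₁ = solve-∀
  lemma₂ : ∀ c k → 16 * (2 * c + suc k) + 1 ≡ 8 * (4 * c + 1 * suc k) + 1 + 8 * suc k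
  lemma₂ = solve-∀
root-square -[1+ k ]  = begin
  (4 * suc k + 1) * (4 * suc k + 1)                   ≡⟨ lemma₁ (suc k) ⟩
  16 * (suc k * suc k) + (8 * suc k + 1)              ≡⟨ cong (λ s → 16 * s + (8 * suc k + 1)) (2*choose2 (suc k)) ⟨
  16 * (2 * choose2 (suc k) + suc k) + (8 * suc k + 1) ≡⟨ lemma₂ (choose2 (suc k)) (suc k) ⟩
  8 * expoℤ 1 3 -[1+ k ] + 1                                ∎
  where
  open ≡-Reasoning
  lemma₁ : ∀ k → (4 * k + 1) * (4 * k + 1) ≡ 16 * (k * k) + (8 * k + 1)
  lemma₁ = solve-∀
  lemma₂ : ∀ c k → 16 * (2 * c + k) + (8 * k + 1) ≡ 8 * (4 * c + 3 * k) + 1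
  lemma₂ = solve-∀

-- Odd numbers that are 3 modulo 4 come from k > 0, those that are 1 modulo 4 from k ≤ 0. Adding 4
-- moves k one step away from zero, and k = 0 continues on the negative side.
root-surjective : ∀ s → (∃ λ t → s ≡ 2 * t) ⊎ (∃ λ k → s ≡ root k)
root-surjective 0 = inj₁ (0 , refl)
root-surjective 1 = inj₂ (+ 0 , refl)
root-surjective 2 = inj₁ (1 , refl)
root-surjective 3 = inj₂ (+ 1 , refl)
root-surjective (suc (suc (suc (suc s)))) with root-surjective s
... | inj₁ (t , refl)        = inj₁ (2 + t , lemma t)
  where
  lemma : ∀ t → 4 + 2 * t ≡ 2 * (2 + t)
  lemma = solve-∀
... | inj₂ (+ zero , refl)   = inj₂ (-[1+ 0 ] , refl)
... | inj₂ (+ suc k , refl)  = inj₂ (+ suc (suc k) , lemma k)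
  where
  lemma : ∀ k → 4 + (4 * k + 3) ≡ 4 * suc k + 3
  lemma = solve-∀
... | inj₂ (-[1+ k ] , refl) = inj₂ (-[1+ suc k ] , lemma k)
  where
  lemma : ∀ k → 4 + (4 * suc k + 1) ≡ 4 * suc (suc k) + 1
  lemma = solve-∀

odd-square : ∀ s → ¬ 2 ∣ s * s → ∃ λ k → s * s ≡ 8 * expoℤ 1 3 k + 1
odd-square s 2∤ with root-surjective s
... | inj₁ (t , refl) = contradiction (∣m⇒∣m*n (2 * t) (m∣m*n t)) 2∤
... | inj₂ (k , refl) = k , root-square k

SquareOr5Square : ℕ → Set
SquareOr5Square M = ∃ λ s → M ≡ s * s ⊎ M ≡ 5 * (s * s)

private
  odd : ∀ j → ¬ 2 ∣ 4 * j + 1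
  odd j p = contradiction (∣1⇒≡1 (∣m+n∣m⇒∣n p (∣m⇒∣m*n j (divides 2 refl)))) λ ()

  mod8 : ∀ m n r s .{{_ : NonZero 8}} → 8 * m + r ≡ 8 * n + s → r % 8 ≡ s % 8
  mod8 m n r s e = trans (sym (residue m r)) (trans (cong (_% 8) e) (residue n s))
    where
    residue : ∀ m r → (8 * m + r) % 8 ≡ r % 8
    residue m r = trans (cong (_% 8) (trans (+-comm (8 * m) r) (cong (λ x → r + x) (*-comm 8 m)))) ([m+kn]%n≡m%n r m 8)

  times5 : ∀ e → 5 * (8 * e + 1) ≡ 8 * (5 * e) + 5
  times5 = solve-∀

-- As 4j + 1 is odd, so is s, and s² is 8·`expoℤ 1 3 k` + 1. The two alternatives then differ modulo
-- 8, so the parity of `j` decides which can occur.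
SquareOr5Square⇒ : ∀ j → SquareOr5Square (4 * j + 1) →
  (∃ λ k → 4 * j + 1 ≡ 8 * expoℤ 1 3 k + 1) ⊎ (∃ λ k → 4 * j + 1 ≡ 8 * expoℤ 5 15 k + 5)
SquareOr5Square⇒ j (s , inj₁ e) with odd-square s (λ p → odd j (subst (2 ∣_) (sym e) p))
... | k , s² = inj₁ (k , trans e s²)
SquareOr5Square⇒ j (s , inj₂ e) with odd-square s (λ p → odd j (subst (2 ∣_) (sym e) (∣n⇒∣m*n 5 p)))
... | k , s² = inj₂ (k , trans e (trans (cong (5 *_) s²)
                 (trans (times5 (expoℤ 1 3 k)) (cong (λ x → 8 * x + 5) (sym (expoℤ-scale k))))))

private
  -- The factor q⁻¹ of j₁₀ moves degree 4j + 2 of the product to 4j + 1.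
  J10-index : ∀ j → let n = suc (j + j) + suc (j + j) in prodUpTo n n ≡ J10 (4 * j + 1)
  J10-index j = trans (cong (λ n → prodUpTo n n) (lemma j)) (cong J10 (+-comm 1 (4 * j)))
    where
    lemma : ∀ j → suc (j + j) + suc (j + j) ≡ 2 + 4 * j
    lemma = solve-∀

  J10-≡₂ : ∀ j N {b} → N ≡ suc (j + j) + suc (j + j) → etaQuotient₂ N N ≡ b → J10 (4 * j + 1) ≡₂ b
  J10-≡₂ j N N≡ e = subst₂ _≡₂_ (trans (cong (λ n → prodUpTo n n) N≡) (J10-index j)) e (prodUpTo-≡₂ N N)

  cancel : ∀ {m n} r → 8 * m + r ≡ 8 * n + r → m ≡ n
  cancel {m} {n} r e = *-cancelˡ-≡ m n 8 (+-cancelʳ-≡ r _ _ e)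

private
  4j+1-even : ∀ i → 4 * (i + i) + 1 ≡ 8 * i + 1
  4j+1-even = solve-∀

  4j+1-odd : ∀ i → 4 * suc (i + i) + 1 ≡ 8 * i + 5
  4j+1-odd = solve-∀

  expoℤ₅-injective : ∀ {k l} → expoℤ 5 15 k ≡ expoℤ 5 15 l → k ≡ l
  expoℤ₅-injective {k} {l} e = expoℤ-injective (*-cancelˡ-≡ _ _ 5 (trans (sym (expoℤ-scale k)) (trans e (expoℤ-scale l))))

Θ₁₃-true⇒ : ∀ N i → Θ 1 3 N i ≡ true → SquareOr5Square (4 * (i + i) + 1)
Θ₁₃-true⇒ N i p with Θ-true⇒ 1 3 N i p
... | k , e = root k , inj₁ (trans (4j+1-even i) (trans (cong (λ x → 8 * x + 1) (sym e)) (sym (root-square k))))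

Θ₁₃-true⇐ : ∀ N i → i ≤ N → SquareOr5Square (4 * (i + i) + 1) → Θ 1 3 N i ≡ true
Θ₁₃-true⇐ N i i≤N p with SquareOr5Square⇒ (i + i) p
... | inj₁ (k , e) = subst (λ x → Θ 1 3 N x ≡ true) k≡i
                       (Θ-true⇐ 1 3 z<s z<s expoℤ-injective N k (subst (_≤ N) (sym k≡i) i≤N))
  where
  k≡i : expoℤ 1 3 k ≡ i
  k≡i = sym (cancel 1 (trans (sym (4j+1-even i)) e))
... | inj₂ (k , e) = contradiction (mod8 i (expoℤ 5 15 k) 1 5 (trans (sym (4j+1-even i)) e)) λ ()

Θ₅₁₅-true⇒ : ∀ N i → Θ 5 15 N i ≡ true → SquareOr5Square (4 * suc (i + i) + 1)
Θ₅₁₅-true⇒ N i p with Θ-true⇒ 5 15 N i p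
... | k , e = root k , inj₂ (begin
  4 * suc (i + i) + 1         ≡⟨ 4j+1-odd i ⟩
  8 * i + 5                     ≡⟨ cong (λ x → 8 * x + 5) (trans (sym e) (expoℤ-scale k)) ⟩
  8 * (5 * expoℤ 1 3 k) + 5   ≡⟨ times5 (expoℤ 1 3 k) ⟨
  5 * (8 * expoℤ 1 3 k + 1)   ≡⟨ cong (5 *_) (root-square k) ⟨
  5 * (root k * root k)         ∎)
  where open ≡-Reasoning

Θ₅₁₅-true⇐ : ∀ N i → i ≤ N → SquareOr5Square (4 * suc (i + i) + 1) → Θ 5 15 N i ≡ true
Θ₅₁₅-true⇐ N i i≤N p with SquareOr5Square⇒ (suc (i + i)) p
... | inj₁ (k , e) = contradiction (mod8 i (expoℤ 1 3 k) 5 1 (trans (sym (4j+1-odd i)) e)) λ ()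
... | inj₂ (k , e) = subst (λ x → Θ 5 15 N x ≡ true) k≡i
                       (Θ-true⇐ 5 15 z<s z<s expoℤ₅-injective N k (subst (_≤ N) (sym k≡i) i≤N))
  where
  k≡i : expoℤ 5 15 k ≡ i
  k≡i = sym (cancel 5 (trans (sym (4j+1-odd i)) e))

-- The parity of the coefficients of degree 4j + 1.

ParityCriterion : ℕ → Set
ParityCriterion j = ∃ λ b → (J10 (4 * j + 1) ≡₂ b) ×
  (b ≡ true → SquareOr5Square (4 * j + 1)) × (SquareOr5Square (4 * j + 1) → b ≡ true)

private
  -- j and N stay variables here: otherwise the type checker expands J10 and Θ term by term.
  parity-even : ∀ i j N → j ≡ i + i → N ≡ suc (j + j) + suc (j + j) → ParityCriterion j
  parity-even i j N j≡ N≡ = Θ 1 3 N i , J10-≡₂ j N N≡ coefficient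
    , subst (λ j → SquareOr5Square (4 * j + 1)) (sym j≡) ∘ Θ₁₃-true⇒ N i
    , Θ₁₃-true⇐ N i i≤N ∘ subst (λ j → SquareOr5Square (4 * j + 1)) j≡
    where
    N≡′ : N ≡ suc (i + i + (i + i)) + suc (i + i + (i + i))
    N≡′ = trans N≡ (cong (λ j → suc (j + j) + suc (j + j)) j≡)
    coefficient : etaQuotient₂ N N ≡ Θ 1 3 N i
    coefficient = trans (cong (etaQuotient₂ N) N≡′) (Level10.etaQuotient-even N i (≤-reflexive (sym N≡′)))
    i≤N : i ≤ N
    i≤N = subst (i ≤_) (sym (trans N≡′ (lemma i))) (m≤m+n i (7 * i + 2))
      where
      lemma : ∀ i → suc (i + i + (i + i)) + suc (i + i + (i + i)) ≡ i + (7 * i + 2)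
      lemma = solve-∀

  parity-odd : ∀ i j N → j ≡ suc (i + i) → N ≡ suc (j + j) + suc (j + j) → ParityCriterion j
  parity-odd i j N j≡ N≡ = Θ 5 15 N i , J10-≡₂ j N N≡ coefficient
    , subst (λ j → SquareOr5Square (4 * j + 1)) (sym j≡) ∘ Θ₅₁₅-true⇒ N i
    , Θ₅₁₅-true⇐ N i i≤N ∘ subst (λ j → SquareOr5Square (4 * j + 1)) j≡
    where
    N≡′ : N ≡ suc (suc (i + i) + suc (i + i)) + suc (suc (i + i) + suc (i + i))
    N≡′ = trans N≡ (cong (λ j → suc (j + j) + suc (j + j)) j≡)
    coefficient : etaQuotient₂ N N ≡ Θ 5 15 N i
    coefficient = trans (cong (etaQuotient₂ N) N≡′) (Level10.etaQuotient-odd N i (≤-reflexive (sym N≡′)))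
    i≤N : i ≤ N
    i≤N = subst (i ≤_) (sym (trans N≡′ (lemma i))) (m≤m+n i (7 * i + 6))
      where
      lemma : ∀ i → suc (suc (i + i) + suc (i + i)) + suc (suc (i + i) + suc (i + i)) ≡ i + (7 * i + 6)
      lemma = solve-∀

parity-criterion : ∀ j → ParityCriterion j
parity-criterion j with halves j
  where
  halves : ∀ j → ∃ λ i → j ≡ i + i ⊎ j ≡ suc (i + i)
  halves zero = 0 , inj₁ refl
  halves (suc j) with halves j
  ... | i , inj₁ refl = i , inj₂ refl
  ... | i , inj₂ refl = suc i , inj₁ (cong suc (sym (+-suc i i)))
... | i , inj₁ j≡ = parity-even i j _ j≡ refl
... | i , inj₂ j≡ = parity-odd i j _ j≡ refl

-- Invariance under multiplication by p², and the theorem.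

SquareOr5Square-scale : ∀ p {M} → SquareOr5Square M → SquareOr5Square (p * p * M)
SquareOr5Square-scale p (s , inj₁ refl) = p * s , inj₁ (lemma p s)
  where
  lemma : ∀ p s → p * p * (s * s) ≡ p * s * (p * s)
  lemma = solve-∀
SquareOr5Square-scale p (s , inj₂ refl) = p * s , inj₂ (lemma p s)
  where
  lemma : ∀ p s → p * p * (5 * (s * s)) ≡ 5 * (p * s * (p * s))
  lemma = solve-∀

-- Euclid's lemma forces `p` to divide `s`, the factor 5 being excluded by hypothesis; then p²
-- cancels.
SquareOr5Square-unscale : ∀ p .{{_ : NonZero p}} {M} → Prime p → ¬ p ∣ 5 → SquareOr5Square (p * p * M) → SquareOr5Square M
SquareOr5Square-unscale p {M} p-prime p∤5 (s , inj₁ e) with p∣s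
  where
  p∣s : p ∣ s
  p∣s = [ id , id ]′ (euclidsLemma s s p-prime (subst (p ∣_) e (∣m⇒∣m*n M (m∣m*n p))))
... | divides t refl = t , inj₁ (*-cancelˡ-≡ M (t * t) (p * p) {{m*n≢0 p p}} (trans e (lemma p t)))
  where
  lemma : ∀ p t → t * p * (t * p) ≡ p * p * (t * t)
  lemma = solve-∀
SquareOr5Square-unscale p {M} p-prime p∤5 (s , inj₂ e) with p∣s
  where
  p∣s : p ∣ s
  p∣s with euclidsLemma 5 (s * s) p-prime (subst (p ∣_) e (∣m⇒∣m*n M (m∣m*n p)))
  ... | inj₁ p∣5  = contradiction p∣5 p∤5
  ... | inj₂ p∣s² = [ id , id ]′ (euclidsLemma s s p-prime p∣s²)
... | divides t refl = t , inj₂ (*-cancelˡ-≡ M (5 * (t * t)) (p * p) {{m*n≢0 p p}} (trans e (lemma p t)))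
  where
  lemma : ∀ p t → 5 * (t * p * (t * p)) ≡ p * p * (5 * (t * t))
  lemma = solve-∀

J10-parity-p² : ∀ p .{{_ : NonZero p}} → Prime p → ¬ p ∣ 5 → ∀ {M M′} j j′ →
  M ≡ 4 * j + 1 → M′ ≡ 4 * j′ + 1 → M′ ≡ p * p * M → (+ 2) ℤD.∣ (J10 M′ ℤ.- J10 M)
J10-parity-p² p p-prime p∤5 j j′ refl refl e with parity-criterion j | parity-criterion j′
... | b , J≡b , to , from | b′ , J′≡b′ , to′ , from′ =
  ≡₂-unique⇒2∣ J′≡b′ (subst (_ ≡₂_) (⇔→≡ {b} {b′} {true} (mk⇔ b⇒b′ b′⇒b)) J≡b)
  where
  b⇒b′ : b ≡ true → b′ ≡ true
  b⇒b′ q = from′ (subst SquareOr5Square (sym e) (SquareOr5Square-scale p (to q)))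
  b′⇒b : b′ ≡ true → b ≡ true
  b′⇒b q = from (SquareOr5Square-unscale p p-prime p∤5 (subst SquareOr5Square e (to′ q)))

≡1-mod-4⇒ : ∀ M → M % 4 ≡ 1 → M ≡ 4 * (M / 4) + 1
≡1-mod-4⇒ M e = trans (m≡m%n+[m/n]*n M 4) (trans (cong (_+ M / 4 * 4) e) (lemma (M / 4)))
  where
  lemma : ∀ x → 1 + x * 4 ≡ 4 * x + 1
  lemma = solve-∀

≡3-mod-4⇒∤5 : ∀ p → p % 4 ≡ 3 → ¬ p ∣ 5
≡3-mod-4⇒∤5 p e p∣5 = go p e p∣5 (∣⇒≤ p∣5)
  where
  go : ∀ p → p % 4 ≡ 3 → p ∣ 5 → p ≤ 5 → ⊥
  go 3 _ q _ = contradiction (n∣m⇒m%n≡0 5 3 q) λ ()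
  go (suc (suc (suc (suc (suc (suc p)))))) _ _ (s≤s (s≤s (s≤s (s≤s (s≤s ())))))

-- 3 is invertible modulo 4: among the residues only 1 satisfies 3r ≡ 3.
mod-4-quotient : ∀ p N → p % 4 ≡ 3 → (p * N) % 4 ≡ 3 → N % 4 ≡ 1
mod-4-quotient p N p≡3 pN≡3 = go (N % 4) (m%n<n N 4) (trans (sym (cong (λ r → r * (N % 4) % 4) p≡3)) (trans (sym (%-distribˡ-* p N 4)) pN≡3))
  where
  go : ∀ r → r < 4 → (3 * r) % 4 ≡ 3 → r ≡ 1
  go 1 _ _ = refl
  go (suc (suc (suc (suc r)))) (s≤s (s≤s (s≤s (s≤s ())))) _

theorem4p3 : (k : ℕ) → 1 ≤ k → (p : ℕ) → .{{_ : NonZero p}} → Prime p → p % 4 ≡ 3 →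
    (δ : ℕ) → p ∣ (4 * δ + 3) → (n : ℕ) →
    (+ 2) ℤD.∣ (J10 (p * (4 * p ^ k * n + 4 * δ + 3)) - J10 (4 * p ^ (k ∸ 1) * n + (4 * δ + 3) / p))
theorem4p3 (suc k) (s≤s _) p p-prime p≡3 δ p∣4δ+3 n =
  J10-parity-p² p p-prime (≡3-mod-4⇒∤5 p p≡3) (M / 4) (M′ / 4) (≡1-mod-4⇒ M M≡1) (≡1-mod-4⇒ M′ M′≡1) M′≡p²M
  where
  -- `M` is N₂ and `M′` is N₁. With the exponent matched as `suc k`, multiplying `M` by `p` gives
  -- the bracket `A` of N₁, so N₁ = p² N₂; and `A` ≡ 3 modulo 4 makes both `M` and `M′` congruent to
  -- 1.
  r = (4 * δ + 3) / p
  M  = 4 * p ^ k * n + r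
  A  = 4 * p ^ suc k * n + 4 * δ + 3
  M′ = p * A
  pM≡A : p * M ≡ A
  pM≡A = trans (lemma p (p ^ k) n r) (trans (cong (λ x → 4 * (p * p ^ k) * n + x) (m/n*n≡m p∣4δ+3))
           (sym (+-assoc (4 * p ^ suc k * n) (4 * δ) 3)))
    where
    lemma : ∀ p q n r → p * (4 * q * n + r) ≡ 4 * (p * q) * n + r * p
    lemma = solve-∀
  M′≡p²M : M′ ≡ p * p * M
  M′≡p²M = trans (cong (p *_) (sym pM≡A)) (sym (*-assoc p p M))
  A≡3 : A % 4 ≡ 3
  A≡3 = trans (cong (_% 4) (lemma (p ^ suc k) n δ)) ([m+kn]%n≡m%n 3 (p ^ suc k * n + δ) 4)
    where
    lemma : ∀ q n δ → 4 * q * n + 4 * δ + 3 ≡ 3 + (q * n + δ) * 4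
    lemma = solve-∀
  M≡1 : M % 4 ≡ 1
  M≡1 = mod-4-quotient p M p≡3 (trans (cong (_% 4) pM≡A) A≡3)
  M′≡1 : M′ % 4 ≡ 1
  M′≡1 = trans (%-distribˡ-* p A 4) (cong₂ (λ x y → (x * y) % 4) p≡3 A≡3)
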